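{- Let $E=\{0,1,\dots,n\}$ and let $M$ be a loopless matroid of rank $r+1$ on $E$. Let $d_0,\dots,d_n$ be nonnegative integers with $d_0+\dots+d_n=r$. Then \[\deg_M(\Lambda_0^{d_0}\cdots\Lambda_n^{d_n})=\sum_{w}(-1)^{n-r+\mathrm{des}(w)},\] where the sum is over all bijections $w:E\to E$ with $\mathrm{Des}(w)=I'_{(d_0,\dots,d_n),K(w)}$.
   Context: The Chow ring $A^*(M)$ (real coefficients) is $\mathbb{R}[x_F : F \text{ a nonempty proper flat of } M]$ modulo the ideal generated by all $x_{F_1}x_{F_2}$ with $F_1,F_2$ incomparable and all $\sum_{F\ni i}x_F-\sum_{F\ni j}x_F$ for $i,j\in E$; $\deg_M:A^r(M)\to\mathbb{R}$ is the linear map with value $1$ on $x_{F_1}\cdots x_{F_r}$ for each complete flag of flats. For $S\subseteq E$, $x_S$ means the generator if $S$ is a nonempty proper flat and $0$ otherwise. Hypersimplex classes: $\gamma_k=\sum_S\left(\min(|S|,k)-\frac{k}{n+1}|S|\right)x_S$ for $1\le k\le n$ (sum over nonempty proper $S\subsetneq E$), and $\gamma_0=\gamma_{n+1}=0$. For $0\le k\le n$, $\Lambda_k=\gamma_k-\gamma_{k+1}\in A^1(M)$ (in the paper, the image of the piecewise-linear function $\lambda_k$, $x\mapsto$ ($(k+1)$st largest coordinate of $x$) $-x_n$, on the permutohedral fan). For a bijection $w:E\to E$: $\mathrm{Des}(w)=\{i\in\{0,\dots,n-1\}: w(i)>w(i+1)\}$, $\mathrm{des}(w)=|\mathrm{Des}(w)|$,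 and $K(w)$ is the set of $i\in E$ such that the closure in $M$ of $\{w(0),\dots,w(i-1)\}$ differs from the closure of $\{w(0),\dots,w(i)\}$ (so $0\in K(w)$ and $|K(w)|=r+1$). For $K\subseteq E$ with $|K|=r+1$, let $c_i=d_i$ if $i\in K$ and $c_i=d_i+1$ if $i\notin K$, and $I'_{(d_0,\dots,d_n),K}=\{i\in\{0,\dots,n-1\}: c_0+\dots+c_i<i+1\}$.
   Formalization: Λ_k is taken as the image of λ_k, with coefficient [|S|≥k+1]−[n∈S] on x_S, i.e. γ_{k+1}−γ_k; with Λ_k=γ_k−γ_{k+1} the formula has the wrong sign for odd r. Rational instead of real coefficients are used, which is equivalent here. -}

module Defs where

open import Data.Bool using (Bool; true; false; if_then_else_; _∧_; _∨_; not)
open import Data.Nat as ℕ using (ℕ; zero; suc; _+_; _*_; _∸_; _≤_; _<_; _≤ᵇ_; _<ᵇ_; _≡ᵇ_)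
open import Data.Fin as Fin using (Fin; toℕ; inject₁)
open import Data.Fin.Subset as Sub using (Subset; _∪_; _∩_; ⁅_⁆; _⊆_; _∉_; Nonempty)
open import Data.Vec as Vec using (Vec; lookup; tabulate)
open import Data.Vec.Functional using (Vector)
open import Data.List as List using (List; []; _∷_; foldr; map; concatMap; replicate; allFin; length)
open import Data.List.Relation.Unary.All using (All)
open import Data.List.Relation.Unary.Any using (Any)
open import Data.List.Relation.Binary.Permutation.Propositional using (_↭_)
open import Data.Nat.ListAction renaming (sum to sumℕ)
open import Data.Rational as ℚ using (ℚ; 0ℚ; 1ℚ)
open import Data.Integer using (+_)
open import Data.Product using (_×_; Σ)
open import Data.Unit using (⊤)
open import Relation.Nullary using (¬_; does)
open import Relation.Binary.PropositionalEquality using (_≡_; _≢_)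

record Matroid (m : ℕ) : Set where
  field
    rk      : Subset m → ℕ
    rk-card : ∀ A → rk A ≤ Sub.∣ A ∣
    rk-mono : ∀ {A B} → A ⊆ B → rk A ≤ rk B
    rk-sub  : ∀ A B → rk (A ∪ B) + rk (A ∩ B) ≤ rk A + rk B

module _ {m : ℕ} (M : Matroid m) where
  open Matroid M

  Loopless : Set
  Loopless = ∀ i → rk ⁅ i ⁆ ≡ 1

  IsFlat : Subset m → Set
  IsFlat F = ∀ x → x ∉ F → rk F < rk (F ∪ ⁅ x ⁆)

  -- nonempty proper flat (these index the generators x_F)
  IsNPFlat : Subset m → Set
  IsNPFlat F = Nonempty F × F ≢ Sub.⊤ × IsFlat F

  cl : Subset m → Subset m
  cl A = tabulate (λ x → rk (A ∪ ⁅ x ⁆) ≡ᵇ rk A)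

  FlagFrom : ℕ → List (Subset m) → Set
  FlagFrom k [] = ⊤
  FlagFrom k (F ∷ Fs) = IsFlat F × rk F ≡ suc k × All (F ⊆_) Fs × FlagFrom (suc k) Fs

  IsCompleteFlag : List (Subset m) → Set
  IsCompleteFlag = FlagFrom 0

sumℚ : List ℚ → ℚ
sumℚ = foldr ℚ._+_ 0ℚ

allSubsets : (m : ℕ) → List (Subset m)
allSubsets zero = Vec.[] ∷ []
allSubsets (suc m) = concatMap (λ S → (true Vec.∷ S) ∷ (false Vec.∷ S) ∷ []) (allSubsets m)

ΣS : {m : ℕ} → (Subset m → ℚ) → ℚ
ΣS {m} f = sumℚ (map f (allSubsets m))

-- Degree map.  A degree-r polynomial in the variables x_S (S ⊆ E) is
-- evaluated by a functional φ on monomials (lists of subsets of length r).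
-- φ is "the degree map deg_M" when it descends to A^r(M) and is 1 on
-- complete flags:

record IsDegreeMap {m : ℕ} (M : Matroid m) (r : ℕ) (φ : List (Subset m) → ℚ) : Set where
  field
    -- commutativity of the polynomial ring
    symm      : ∀ ms ms' → length ms ≡ r → ms ↭ ms' → φ ms ≡ φ ms'
    -- x_S = 0 unless S is a nonempty proper flat
    nonflat   : ∀ ms → length ms ≡ r → ∀ S → Any (S ≡_) ms → ¬ IsNPFlat M S → φ ms ≡ 0ℚ
    -- x_F x_G ∈ ideal for incomparable flats F, G
    incomp    : ∀ F G ms → suc (suc (length ms)) ≡ r → IsNPFlat M F → IsNPFlat M G →
                ¬ (F ⊆ G) → ¬ (G ⊆ F) → φ (F ∷ G ∷ ms) ≡ 0ℚ
    -- Σ_{F ∋ i} x_F − Σ_{F ∋ j} x_F ∈ ideal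
    linear    : ∀ (i j : Fin m) ms → suc (length ms) ≡ r →
                ΣS (λ S → if lookup S i then φ (S ∷ ms) else 0ℚ)
                  ≡ ΣS (λ S → if lookup S j then φ (S ∷ ms) else 0ℚ)
    flag      : ∀ ms → length ms ≡ r → IsCompleteFlag M ms → φ ms ≡ 1ℚ

-- linear forms Σ_S a(S) x_S, given by coefficient functions
Lin : ℕ → Set
Lin m = Subset m → ℚ

-- φ applied to the product of a list of linear forms (expanded multilinearly)
evalProd : {m : ℕ} → (List (Subset m) → ℚ) → List (Lin m) → ℚ
evalProd φ [] = φ []
evalProd φ (L ∷ Ls) = ΣS (λ S → L S ℚ.* evalProd (λ ms → φ (S ∷ ms)) Ls)

ℕtoℚ : ℕ → ℚ
ℕtoℚ a = (+ a) ℚ./ 1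

γ : (n k : ℕ) → Lin (suc n)
γ n k S = if (1 ≤ᵇ k) ∧ (k ≤ᵇ n)
          then ℕtoℚ (ℕ._⊓_ Sub.∣ S ∣ k) ℚ.- ((+ (k * Sub.∣ S ∣)) ℚ./ suc n)
          else 0ℚ

Λ : (n k : ℕ) → Lin (suc n)
Λ n k S = ℕtoℚ (if suc k ≤ᵇ Sub.∣ S ∣ then 1 else 0)
          ℚ.- ℕtoℚ (if lookup S (Fin.fromℕ n) then 1 else 0)

Λprod : (n : ℕ) → Vector ℕ (suc n) → List (Lin (suc n))
Λprod n d = concatMap (λ k → replicate (d k) (Λ n (toℕ k))) (allFin (suc n))

sumVec : {m : ℕ} → Vector ℕ m → ℕ
sumVec {m} d = sumℕ (map d (allFin m))

anyFin : (m : ℕ) → (Fin m → Bool) → Bool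
anyFin m p = foldr _∨_ false (map p (allFin m))

allFin? : (m : ℕ) → (Fin m → Bool) → Bool
allFin? m p = foldr _∧_ true (map p (allFin m))

_==_ : {m : ℕ} → Fin m → Fin m → Bool
a == b = does (a Fin.≟ b)

allFuns : {A : Set} → (k : ℕ) → List A → List (Vector A k)
allFuns zero xs = (λ ()) ∷ []
allFuns (suc k) xs = concatMap (λ a → map (λ f → Data.Vec.Functional._∷_ a f) (allFuns k xs)) xs

isBijᵇ : {m : ℕ} → Vector (Fin m) m → Bool
isBijᵇ {m} w = allFin? m (λ i → allFin? m (λ j → (i == j) ∨ not (w i == w j)))

inDes : {n : ℕ} → Vector (Fin (suc n)) (suc n) → Fin n → Bool
inDes w i = toℕ (w (Fin.suc i)) <ᵇ toℕ (w (inject₁ i))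

des : {n : ℕ} → Vector (Fin (suc n)) (suc n) → ℕ
des {n} w = List.length (List.filterᵇ (inDes w) (allFin n))

prefix : {m : ℕ} → Vector (Fin m) m → ℕ → Subset m
prefix {m} w k = tabulate (λ x → anyFin m (λ j → (toℕ j <ᵇ k) ∧ (w j == x)))

subsetEqᵇ : {m : ℕ} → Subset m → Subset m → Bool
subsetEqᵇ {m} A B = allFin? m (λ x → not (lookup A x Data.Bool.xor lookup B x))

inK : {m : ℕ} → Matroid m → Vector (Fin m) m → Fin m → Bool
inK M w i = not (subsetEqᵇ (cl M (prefix w (toℕ i))) (cl M (prefix w (suc (toℕ i)))))

inI' : {n : ℕ} → Vector ℕ (suc n) → (Fin (suc n) → Bool) → Fin n → Bool
inI' {n} d K i = partial <ᵇ suc (toℕ i)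
  where
  c : Fin (suc n) → ℕ
  c j = if K j then d j else suc (d j)
  partial : ℕ
  partial = sumℕ (map (λ j → if toℕ j ≤ᵇ toℕ i then c j else 0) (allFin (suc n)))

desCond : {n : ℕ} → Matroid (suc n) → Vector ℕ (suc n) → Vector (Fin (suc n)) (suc n) → Bool
desCond {n} M d w = allFin? n (λ i → not (inDes w i Data.Bool.xor inI' d (inK M w) i))

negOnePow : ℕ → ℚ
negOnePow zero = 1ℚ
negOnePow (suc k) = ℚ.- negOnePow k

rhs : (n r : ℕ) → Matroid (suc n) → Vector ℕ (suc n) → ℚ
rhs n r M d = sumℚ (map (λ w → if isBijᵇ w ∧ desCond M d w
                                then negOnePow ((n ∸ r) + des w) else 0ℚ)
                        (allFuns (suc n) (allFin (suc n))))

{-# OPTIONS --safe #-}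
module Submission where

-- For a chain of flats and a factor Λ_k, the linear relations let us write Λ_k with
-- a linear form x_j, j in the interval F ⊂ G of the chain with |F| ≤ k < |G|; then only
-- flats of that interval contribute and Λ_k refines the chain, with coefficient
-- [|H| > k] − [j ∈ H] at H.  This determines the degree recursively.
--
-- On the other side, the right hand side is the constant coefficient of
--   Σ_w Π_i t_{w(i)}^{c_i} / Π_i (t_{w(i)} − t_{w(i+1)}),   |t_0| ≫ |t_1| ≫ … ,
-- since expanding each 1/(t_x − t_y) geometrically gives the condition Des(w) = I′.
-- Multiplying the numerator by t_{w(k)} − t_j and telescoping cancels one denominator
-- at a time, which cuts w at a set H: this is the same recursion.  The correction term
-- t_j (…) has no constant coefficient when j is the maximum of the interval, because
-- then t_j occurs with nonnegative exponents only.  For non-flat H the minor M/H has a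
-- loop and its sum vanishes, by reduction to rank one.

-- No Laurent series is built, only its coefficients. Requiring exponent zero at every letter forces
-- s_i = s_{i-1} + c_i - 1, hence s_i = c_0 + ... + c_i - (i+1). So each word has at most one
-- contributing term, and besides the letters the running total of exponents is all that has to be
-- remembered. A word can be cut because c_i depends on it only through the set of earlier letters
-- and the letter itself: d_i through the size of that set, membership in K(w) through its closure.
-- After a cut at H the two pieces range independently over the orderings of H minus A and of B
-- minus H, and each piece is a sum of the original kind. This is why everything is set up for
-- arbitrary pairs A ⊆ B and not only for the whole ground set.

open import Defs
open import Data.Bool using (Bool; true; false; if_then_else_; _∧_; _∨_; not; _xor_)
open import Data.Bool.Properties as Bool using (∨-zeroʳ; xor-same; ¬-not)
open import Data.Empty using (⊥-elim)
open import Data.Fin as Fin using (Fin; zero; suc; toℕ; inject₁)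
import Data.Fin.Properties as Fin
open import Data.Fin.Subset using (Subset; Nonempty; ⊤; ⊥; ⁅_⁆; ∣_∣; _∪_; _∩_; _∈_; _∉_; _⊆_)
open import Data.Fin.Subset.Properties using (_∈?_; _⊆?_; ∉⊥; ∈⊤; ⊆⊤; ⊆-refl; ⊆-antisym; nonempty?; x∈⁅x⁆; x∈⁅y⁆⇒x≡y; x∈p∩q⁺; x∈p∪q⁻; p⊆p∪q; q⊆p∪q; ∪-identityʳ; drop-not-there; ∣p∣≤n; ∣p∣≡n⇒p≡⊤; p⊆q⇒∣p∣≤∣q∣; ∣⊤∣≡n; ∣⊥∣≡0; ∣⁅x⁆∣≡1)
open import Data.List using (List; []; _∷_; _++_; map; length; allFin; concatMap; replicate; foldr; filterᵇ; tabulate)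
open import Data.List.Properties using (length-++; length-map; length-replicate; ++-identityʳ; map-∘; map-tabulate; map-replicate; map-concatMap; concatMap-cong)
import Data.List.Membership.Propositional as List
open import Data.List.Membership.Propositional.Properties using (∈-∃++; ∈-++⁺ˡ; ∈-++⁺ʳ; ∈-insert)
open import Data.List.Relation.Binary.Permutation.Propositional using (_↭_; ↭-refl; ↭-sym; ↭-trans; prep; swap)
open import Data.List.Relation.Binary.Permutation.Propositional.Properties using (shift; ↭-length; ++⁺ʳ)
open import Data.List.Relation.Unary.All as All using (All; []; _∷_)
import Data.List.Relation.Unary.All.Properties as All
open import Data.List.Relation.Unary.Any using (here; there)
open import Data.Nat as ℕ using (ℕ; zero; suc; _∸_; _≤_; _<_; _≤?_; _≤ᵇ_; _<ᵇ_; z≤n; s≤s)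
import Data.Nat.Properties as ℕ
open import Data.Nat.ListAction using () renaming (sum to sumℕ)
open import Data.Nat.Tactic.RingSolver using (solve-∀)
open import Data.Product using (∃; ∃₂; _×_; _,_; proj₁; proj₂)
open import Data.Rational using (ℚ; 0ℚ; 1ℚ; _+_; _*_; -_; _-_)
open import Data.Rational.Properties using (+-assoc; +-identityˡ; +-identityʳ; *-assoc; *-comm; *-zeroˡ; *-zeroʳ; *-identityˡ; *-identityʳ; *-distribˡ-+; *-distribʳ-+)
open import Data.Rational.Solver using (module +-*-Solver)
open import Data.Sum using (_⊎_; inj₁; inj₂)
open import Data.Unit using (tt)
open import Data.Vec as Vec using (_∷_; []; lookup)
open import Data.Vec.Functional as Vector using (Vector; tail)
open import Data.Vec.Properties as Vec using ([]=⇒lookup; lookup⇒[]=; lookup∘tabulate)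
open import Function using (_∘_)
open import Relation.Binary.Definitions using (tri<; tri≈; tri>)
open import Relation.Binary.PropositionalEquality using (_≡_; _≢_; refl; sym; trans; cong; cong₂; subst; module ≡-Reasoning)
open import Relation.Nullary using (Dec; yes; no; ¬_; does)
open import Relation.Nullary.Decidable using (dec-true; dec-false; _×-dec_; ¬?; decidable-stable)

-- Finite sums

*-zeroʳ′ : ∀ c {q} → q ≡ 0ℚ → c * q ≡ 0ℚ
*-zeroʳ′ c refl = *-zeroʳ c

*-zeroˡ′ : ∀ c {q} → q ≡ 0ℚ → q * c ≡ 0ℚ
*-zeroˡ′ c refl = *-zeroˡ c

+-zero : ∀ {q q′} → q ≡ 0ℚ → q′ ≡ 0ℚ → q + q′ ≡ 0ℚ
+-zero refl refl = refl

∑ : {X : Set} → List X → (X → ℚ) → ℚ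
∑ xs f = sumℚ (map f xs)

module _ {X : Set} where

  ∑-cong : (xs : List X) {f g : X → ℚ} → (∀ x → f x ≡ g x) → ∑ xs f ≡ ∑ xs g
  ∑-cong []       f≗g = refl
  ∑-cong (x ∷ xs) f≗g = cong₂ _+_ (f≗g x) (∑-cong xs f≗g)

  ∑-zero : (xs : List X) {f : X → ℚ} → (∀ x → f x ≡ 0ℚ) → ∑ xs f ≡ 0ℚ
  ∑-zero []       f≗0 = refl
  ∑-zero (x ∷ xs) f≗0 = trans (cong₂ _+_ (f≗0 x) (∑-zero xs f≗0)) (+-identityˡ 0ℚ)

  ∑-+ : (xs : List X) (f g : X → ℚ) → ∑ xs (λ x → f x + g x) ≡ ∑ xs f + ∑ xs g
  ∑-+ []       f g = sym (+-identityˡ 0ℚ)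
  ∑-+ (x ∷ xs) f g = trans (cong (f x + g x +_) (∑-+ xs f g))
    (solve 4 (λ a b c d → a :+ b :+ (c :+ d) := a :+ c :+ (b :+ d)) refl (f x) (g x) _ _)
    where open +-*-Solver

  ∑-*ˡ : (xs : List X) (c : ℚ) (f : X → ℚ) → ∑ xs (λ x → c * f x) ≡ c * ∑ xs f
  ∑-*ˡ []       c f = sym (*-zeroʳ c)
  ∑-*ˡ (x ∷ xs) c f = trans (cong (c * f x +_) (∑-*ˡ xs c f)) (sym (*-distribˡ-+ c _ _))

  ∑-*ʳ : (xs : List X) (c : ℚ) (f : X → ℚ) → ∑ xs (λ x → f x * c) ≡ ∑ xs f * c
  ∑-*ʳ xs c f = trans (∑-cong xs (λ x → *-comm (f x) c)) (trans (∑-*ˡ xs c f) (*-comm c _))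

  ∑-neg : (xs : List X) (f : X → ℚ) → ∑ xs (λ x → - f x) ≡ - ∑ xs f
  ∑-neg []       f = refl
  ∑-neg (x ∷ xs) f = trans (cong (- f x +_) (∑-neg xs f))
    (solve 2 (λ a b → :- a :+ :- b := :- (a :+ b)) refl (f x) _)
    where open +-*-Solver

  ∑-++ : (xs ys : List X) (f : X → ℚ) → ∑ (xs ++ ys) f ≡ ∑ xs f + ∑ ys f
  ∑-++ []       ys f = sym (+-identityˡ _)
  ∑-++ (x ∷ xs) ys f = trans (cong (f x +_) (∑-++ xs ys f)) (sym (+-assoc (f x) _ _))

∑-concatMap : {X Y : Set} (g : X → List Y) (xs : List X) (f : Y → ℚ) →
              ∑ (concatMap g xs) f ≡ ∑ xs (λ x → ∑ (g x) f)
∑-concatMap g []       f = refl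
∑-concatMap g (x ∷ xs) f = trans (∑-++ (g x) (concatMap g xs) f) (cong (∑ (g x) f +_) (∑-concatMap g xs f))

∑-map : {X Y : Set} (g : X → Y) (xs : List X) (f : Y → ℚ) → ∑ (map g xs) f ≡ ∑ xs (f ∘ g)
∑-map g xs f = cong sumℚ (sym (map-∘ xs))

∑-swap : {X Y : Set} (xs : List X) (ys : List Y) (f : X → Y → ℚ) →
         ∑ xs (λ x → ∑ ys (f x)) ≡ ∑ ys (λ y → ∑ xs (λ x → f x y))
∑-swap []       ys f = sym (∑-zero ys (λ _ → refl))
∑-swap (x ∷ xs) ys f = trans (cong (∑ ys (f x) +_) (∑-swap xs ys f)) (sym (∑-+ ys (f x) _))

ind : {P : Set} → Dec P → ℚ
ind (yes _) = 1ℚ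
ind (no  _) = 0ℚ

ind-yes : {P : Set} (P? : Dec P) → P → ind P? ≡ 1ℚ
ind-yes (yes _) _ = refl
ind-yes (no ¬p) p = ⊥-elim (¬p p)

ind-no : {P : Set} (P? : Dec P) → ¬ P → ind P? ≡ 0ℚ
ind-no (yes p) ¬p = ⊥-elim (¬p p)
ind-no (no _)  _  = refl

does⁻ : {P : Set} (P? : Dec P) → does P? ≡ true → P
does⁻ (yes p) _ = p

∑Fin : {m : ℕ} → (Fin m → ℚ) → ℚ
∑Fin {m} = ∑ (allFin m)

∑Fin-suc : {m : ℕ} (f : Fin (suc m) → ℚ) → ∑Fin f ≡ f zero + ∑Fin (f ∘ suc)
∑Fin-suc {m} f = cong (λ l → f zero + sumℚ l) (trans (map-tabulate suc f) (sym (map-tabulate (λ i → i) (f ∘ suc))))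

∑Fin-single : {m : ℕ} (i : Fin m) (f : Fin m → ℚ) → (∀ j → j ≢ i → f j ≡ 0ℚ) → ∑Fin f ≡ f i
∑Fin-single {suc m} zero f f≡0 = trans (∑Fin-suc f)
  (trans (cong (f zero +_) (∑-zero (allFin m) (λ j → f≡0 (suc j) λ ()))) (+-identityʳ _))
∑Fin-single {suc m} (suc i) f f≡0 = trans (∑Fin-suc f)
  (trans (cong₂ _+_ (f≡0 zero λ ()) (∑Fin-single i (f ∘ suc) (λ j j≢i → f≡0 (suc j) (j≢i ∘ Fin.suc-injective)))) (+-identityˡ _))

_≟ₛ_ : {m : ℕ} (A B : Subset m) → Dec (A ≡ B)
_≟ₛ_ = Vec.≡-dec Bool._≟_

ΣS-single : {m : ℕ} (B : Subset m) (f : Subset m → ℚ) → (∀ A → A ≢ B → f A ≡ 0ℚ) → ΣS f ≡ f B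
ΣS-single {zero} [] f f≡0 = +-identityʳ (f [])
ΣS-single {suc m} (b ∷ B) f f≡0 = begin
  ΣS f                                                                  ≡⟨ ∑-concatMap _ (allSubsets m) f ⟩
  ΣS (λ S → f (true ∷ S) + (f (false ∷ S) + 0ℚ))                        ≡⟨ ΣS-single B _ (λ A A≢B → trans (cong₂ (λ u v → u + (v + 0ℚ)) (f≡0 _ (A≢B ∘ Vec.∷-injectiveʳ)) (f≡0 _ (A≢B ∘ Vec.∷-injectiveʳ))) refl) ⟩
  f (true ∷ B) + (f (false ∷ B) + 0ℚ)                                   ≡⟨ pick b f≡0 ⟩
  f (b ∷ B)                                                             ∎
  where
  open ≡-Reasoning
  pick : ∀ b → (∀ A → A ≢ b ∷ B → f A ≡ 0ℚ) → f (true ∷ B) + (f (false ∷ B) + 0ℚ) ≡ f (b ∷ B)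
  pick true  z = trans (cong (λ v → f (true ∷ B) + (v + 0ℚ)) (z (false ∷ B) λ ())) (+-identityʳ (f (true ∷ B)))
  pick false z = trans (cong₂ _+_ (z (true ∷ B) λ ()) (+-identityʳ (f (false ∷ B)))) (+-identityˡ (f (false ∷ B)))

-- Path sums

infixl 6 _▹_

_▹_ : {m : ℕ} → Subset m → Fin m → Subset m
A ▹ y = A ∪ ⁅ y ⁆

module _ {m : ℕ} where

  A⊆A▹y : (A : Subset m) (y : Fin m) → A ⊆ A ▹ y
  A⊆A▹y A y = p⊆p∪q ⁅ y ⁆

  y∈A▹y : (A : Subset m) (y : Fin m) → y ∈ A ▹ y
  y∈A▹y A y = q⊆p∪q A ⁅ y ⁆ (x∈⁅x⁆ y)

  ∈▹⁻ : (A : Subset m) {x y : Fin m} → x ∈ A ▹ y → x ∈ A ⊎ x ≡ y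
  ∈▹⁻ A {x} {y} x∈ with x∈p∪q⁻ A ⁅ y ⁆ x∈
  ... | inj₁ x∈A = inj₁ x∈A
  ... | inj₂ x∈y = inj₂ (x∈⁅y⁆⇒x≡y y x∈y)

  ∉▹ : (A : Subset m) {x y : Fin m} → x ∉ A → x ≢ y → x ∉ A ▹ y
  ∉▹ A x∉A x≢y x∈ with ∈▹⁻ A x∈
  ... | inj₁ x∈A = x∉A x∈A
  ... | inj₂ x≡y = x≢y x≡y

  ▹-⊆ : {A B : Subset m} {y : Fin m} → A ⊆ B → y ∈ B → A ▹ y ⊆ B
  ▹-⊆ {A} A⊆B y∈B x∈ with ∈▹⁻ A x∈
  ... | inj₁ x∈A  = A⊆B x∈A
  ... | inj₂ refl = y∈B

∣▹∣ : {m : ℕ} (A : Subset m) {y : Fin m} → y ∉ A → ∣ A ▹ y ∣ ≡ suc ∣ A ∣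
∣▹∣ (true  ∷ A) {zero}  y∉A = ⊥-elim (y∉A Vec.here)
∣▹∣ (false ∷ A) {zero}  y∉A = cong (suc ∘ ∣_∣) (∪-identityʳ A)
∣▹∣ (true  ∷ A) {suc y} y∉A = cong suc (∣▹∣ A (drop-not-there y∉A))
∣▹∣ (false ∷ A) {suc y} y∉A = ∣▹∣ A (drop-not-there y∉A)

-- Induction on the number of missing elements: a path sum at `A` refers only to path sums at the
-- sets `A ▹ y`.
▹-induction : {m : ℕ} (P : Subset m → Set) → (∀ A → (∀ y → y ∉ A → P (A ▹ y)) → P A) → ∀ A → P A
▹-induction {m} P step A = go (m ∸ ∣ A ∣) A ℕ.≤-refl
  where
  go : ∀ f A → m ∸ ∣ A ∣ ≤ f → P A
  go f A m∸≤f = step A λ y y∉A → below f y∉A m∸≤f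
    where
    m∸<m∸ : ∀ {y} → y ∉ A → m ∸ ∣ A ▹ y ∣ < m ∸ ∣ A ∣
    m∸<m∸ y∉A = ℕ.∸-monoʳ-< (ℕ.≤-reflexive (sym (∣▹∣ A y∉A))) (∣p∣≤n (A ▹ _))
    below : ∀ f {y} → y ∉ A → m ∸ ∣ A ∣ ≤ f → P (A ▹ y)
    below zero    y∉A le = ⊥-elim (ℕ.n≮0 (ℕ.<-≤-trans (m∸<m∸ y∉A) le))
    below (suc f) y∉A le = go f _ (ℕ.≤-pred (ℕ.<-≤-trans (m∸<m∸ y∉A) le))

maximum : {m : ℕ} {P : Fin m → Set} → (∀ x → Dec (P x)) → ∃ P → ∃ λ j → P j × (∀ y → P y → toℕ y ≤ toℕ j)
maximum {suc m} {P} P? (x , Px) with Fin.any? (P? ∘ suc)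
... | yes w with maximum (P? ∘ suc) w
... | j , Pj , ub = suc j , Pj , λ { zero _ → z≤n ; (suc y) Py → s≤s (ub y Py) }
maximum {suc m} {P} P? (zero  , Px) | no ¬w = zero , Px , λ { zero _ → z≤n ; (suc y) Py → ⊥-elim (¬w (y , Py)) }
maximum {suc m} {P} P? (suc x , Px) | no ¬w = ⊥-elim (¬w (x , Px))

unless : {P : Set} → Dec P → ℚ → ℚ
unless (yes _) q = 0ℚ
unless (no  _) q = q

∑∉ : {m : ℕ} → Subset m → (Fin m → ℚ) → ℚ
∑∉ A f = ∑Fin (λ y → unless (y ∈? A) (f y))

module _ {m : ℕ} (A : Subset m) where

  ∑∉-cong : {f g : Fin m → ℚ} → (∀ y → y ∉ A → f y ≡ g y) → ∑∉ A f ≡ ∑∉ A g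
  ∑∉-cong {f} {g} f≗g = ∑-cong (allFin m) h
    where
    h : ∀ y → unless (y ∈? A) (f y) ≡ unless (y ∈? A) (g y)
    h y with y ∈? A
    ... | yes _  = refl
    ... | no y∉A = f≗g y y∉A

  ∑∉-zero : {f : Fin m → ℚ} → (∀ y → y ∉ A → f y ≡ 0ℚ) → ∑∉ A f ≡ 0ℚ
  ∑∉-zero {f} f≗0 = ∑-zero (allFin m) h
    where
    h : ∀ y → unless (y ∈? A) (f y) ≡ 0ℚ
    h y with y ∈? A
    ... | yes _  = refl
    ... | no y∉A = f≗0 y y∉A

  ∑∉-single : {f : Fin m → ℚ} (z : Fin m) → z ∉ A → (∀ y → y ∉ A → y ≢ z → f y ≡ 0ℚ) → ∑∉ A f ≡ f z
  ∑∉-single {f} z z∉A f≗0 = trans (∑Fin-single z (λ y → unless (y ∈? A) (f y)) h) at-z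
    where
    h : ∀ y → y ≢ z → unless (y ∈? A) (f y) ≡ 0ℚ
    h y y≢z with y ∈? A
    ... | yes _  = refl
    ... | no y∉A = f≗0 y y∉A y≢z
    at-z : unless (z ∈? A) (f z) ≡ f z
    at-z with z ∈? A
    ... | yes z∈A = ⊥-elim (z∉A z∈A)
    ... | no _    = refl

  ∑∉-+ : (f g : Fin m → ℚ) → ∑∉ A (λ y → f y + g y) ≡ ∑∉ A f + ∑∉ A g
  ∑∉-+ f g = trans (∑-cong (allFin m) h) (∑-+ (allFin m) _ _)
    where
    h : ∀ y → unless (y ∈? A) (f y + g y) ≡ unless (y ∈? A) (f y) + unless (y ∈? A) (g y)
    h y with y ∈? A
    ... | yes _ = refl
    ... | no _  = refl

  ∑∉-*ˡ : (c : ℚ) (f : Fin m → ℚ) → ∑∉ A (λ y → c * f y) ≡ c * ∑∉ A f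
  ∑∉-*ˡ c f = trans (∑-cong (allFin m) h) (∑-*ˡ (allFin m) c _)
    where
    h : ∀ y → unless (y ∈? A) (c * f y) ≡ c * unless (y ∈? A) (f y)
    h y with y ∈? A
    ... | yes _ = sym (*-zeroʳ c)
    ... | no _  = refl

  ∑∉-ΣS : (f : Fin m → Subset m → ℚ) → ∑∉ A (λ y → ΣS (f y)) ≡ ΣS (λ H → ∑∉ A (λ y → f y H))
  ∑∉-ΣS f = trans (∑-cong (allFin m) h) (∑-swap (allFin m) (allSubsets m) _)
    where
    h : ∀ y → unless (y ∈? A) (ΣS (f y)) ≡ ΣS (λ H → unless (y ∈? A) (f y H))
    h y with y ∈? A
    ... | yes _ = sym (∑-zero (allSubsets m) (λ _ → refl))
    ... | no _  = refl

-- The sign of the coefficient of t_x^(-1-s) t_y^s in 1/(t_x − t_y): the first argument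
-- decides x < y, the second s ≥ 0.
ε : {X Y : Set} → Dec X → Dec Y → ℚ
ε (yes _) (yes _) = 1ℚ
ε (no  _) (no  _) = - 1ℚ
ε (yes _) (no  _) = 0ℚ
ε (no  _) (yes _) = 0ℚ

-- The identity (t_x - t_y) · 1/(t_x - t_y) = 1 read off coefficientwise: consecutive coefficients
-- agree except from s = -1 to s = 0, where they rise by one, from -1 to 0 for a descent and from 0
-- to 1 for an ascent.
ε-suc : {X : Set} (X? : Dec X) (k P : ℕ) → ε X? (k ≤? suc P) ≡ ε X? (k ≤? P) + ind (suc P ℕ.≟ k)
ε-suc X? k P with k ≤? suc P | k ≤? P | suc P ℕ.≟ k
ε-suc X?      k P | yes k≤sP | yes k≤P | yes refl = ⊥-elim (ℕ.<-irrefl refl k≤P)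
ε-suc (yes _) k P | yes k≤sP | yes k≤P | no _     = refl
ε-suc (no _)  k P | yes k≤sP | yes k≤P | no _     = refl
ε-suc (yes _) k P | yes k≤sP | no k≰P  | yes _    = refl
ε-suc (no _)  k P | yes k≤sP | no k≰P  | yes _    = refl
ε-suc X?      k P | yes k≤sP | no k≰P  | no sP≢k  = ⊥-elim (k≰P (ℕ.≤-pred (ℕ.≤∧≢⇒< k≤sP (sP≢k ∘ sym))))
ε-suc X?      k P | no k≰sP  | yes k≤P | _        = ⊥-elim (k≰sP (ℕ.m≤n⇒m≤1+n k≤P))
ε-suc X?      k P | no k≰sP  | no _    | yes refl = ⊥-elim (k≰sP ℕ.≤-refl)
ε-suc (yes _) k P | no k≰sP  | no _    | no _     = refl
ε-suc (no _)  k P | no k≰sP  | no _    | no _     = refl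

bit : Bool → ℕ
bit true  = 1
bit false = 0

bitℚ : Bool → ℚ
bitℚ true  = 1ℚ
bitℚ false = 0ℚ

module _ {m : ℕ} where

  Step : Set
  Step = Subset m → Fin m → ℕ

  -- In a state (A, p, P), A is the set of letters of the word so far, p is one more than
  -- its last letter (0 at the start, so that the first letter is always an ascent), and P
  -- is the size of the starting set plus the sum of the exponents so far; the s of ε is
  -- P − |A|.
  edge : Subset m → ℕ → ℕ → Fin m → ℚ
  edge A p P y = ε (p ≤? toℕ y) (∣ A ∣ ≤? P)

  -- A path may stop in any state, and `R` is the value of stopping there. One recursion thus serves
  -- words with a prescribed final set as well as words that are cut midway.
  pathSumUpTo : Step → (Subset m → ℕ → ℚ) → ℕ → Subset m → ℕ → ℕ → ℚ
  pathSumUpTo a R zero    A p P = R A P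
  pathSumUpTo a R (suc f) A p P = R A P + ∑∉ A (λ y →
    edge A p P y * pathSumUpTo a R f (A ▹ y) (suc (toℕ y)) (P ℕ.+ a A y))

  pathSum : Step → (Subset m → ℕ → ℚ) → Subset m → ℕ → ℕ → ℚ
  pathSum a R A p P = pathSumUpTo a R (m ∸ ∣ A ∣) A p P

  next : Step → (Subset m → ℕ → ℚ) → Subset m → ℕ → ℕ → Fin m → ℚ
  next a R A p P y = edge A p P y * pathSum a R (A ▹ y) (suc (toℕ y)) (P ℕ.+ a A y)

  pathSum-step : ∀ a R A p P → pathSum a R A p P ≡ R A P + ∑∉ A (next a R A p P)
  pathSum-step a R A p P with m ∸ ∣ A ∣ in eq
  ... | zero  = sym (trans (cong (R A P +_) (∑∉-zero A (λ y y∉A → ⊥-elim (y∉A (subst (y ∈_) (sym A≡⊤) ∈⊤))))) (+-identityʳ _))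
    where
    A≡⊤ : A ≡ ⊤
    A≡⊤ = ∣p∣≡n⇒p≡⊤ (ℕ.≤-antisym (∣p∣≤n A) (ℕ.m∸n≡0⇒m≤n eq))
  ... | suc f = cong (R A P +_) (∑∉-cong A (λ y y∉A →
    cong (λ g → edge A p P y * pathSumUpTo a R g (A ▹ y) (suc (toℕ y)) (P ℕ.+ a A y)) (fuel y∉A)))
    where
    fuel : ∀ {y} → y ∉ A → f ≡ m ∸ ∣ A ▹ y ∣
    fuel y∉A = trans (cong ℕ.pred (sym eq)) (trans (ℕ.pred[m∸n]≡m∸[1+n] m ∣ A ∣) (cong (m ∸_) (sym (∣▹∣ A y∉A))))

  pathSum-+ : ∀ a R R′ A p P → pathSum a (λ H P → R H P + R′ H P) A p P ≡ pathSum a R A p P + pathSum a R′ A p P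
  pathSum-+ a R R′ = ▹-induction _ λ A IH p P → begin
    pathSum a _ A p P
      ≡⟨ pathSum-step a _ A p P ⟩
    R A P + R′ A P + ∑∉ A (next a (λ H P → R H P + R′ H P) A p P)
      ≡⟨ cong (R A P + R′ A P +_) (∑∉-cong A (λ y y∉A → trans (cong (edge A p P y *_) (IH y y∉A _ _)) (*-distribˡ-+ (edge A p P y) _ _))) ⟩
    R A P + R′ A P + ∑∉ A (λ y → next a R A p P y + next a R′ A p P y)
      ≡⟨ cong (R A P + R′ A P +_) (∑∉-+ A _ _) ⟩
    R A P + R′ A P + (∑∉ A (next a R A p P) + ∑∉ A (next a R′ A p P))
      ≡⟨ solve 4 (λ a b c d → a :+ b :+ (c :+ d) := a :+ c :+ (b :+ d)) refl (R A P) (R′ A P) _ _ ⟩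
    R A P + ∑∉ A (next a R A p P) + (R′ A P + ∑∉ A (next a R′ A p P))
      ≡⟨ sym (cong₂ _+_ (pathSum-step a R A p P) (pathSum-step a R′ A p P)) ⟩
    pathSum a R A p P + pathSum a R′ A p P ∎
    where open ≡-Reasoning
          open +-*-Solver

  -- No denominator follows the last letter, so its exponent is zero exactly when s = -1, that is
  -- `suc P ≡ ∣ A ∣`.
  endAt : Subset m → Subset m → ℕ → ℚ
  endAt B A P = ind (A ≟ₛ B) * ind (suc P ℕ.≟ ∣ A ∣)

  pathsTo : Step → Subset m → Subset m → ℕ → ℕ → ℚ
  pathsTo a B = pathSum a (endAt B)

  endAt-no : ∀ A B P → A ≢ B → endAt B A P ≡ 0ℚ
  endAt-no A B P A≢B = *-zeroˡ′ (ind (suc P ℕ.≟ ∣ A ∣)) (ind-no (A ≟ₛ B) A≢B)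

  endAt-yes : ∀ B P → endAt B B P ≡ ind (suc P ℕ.≟ ∣ B ∣)
  endAt-yes B P = trans (cong (_* ind (suc P ℕ.≟ ∣ B ∣)) (ind-yes (B ≟ₛ B) refl)) (*-identityˡ _)

  pathsTo-outside : ∀ a B A x p P → x ∈ A → x ∉ B → pathsTo a B A p P ≡ 0ℚ
  pathsTo-outside a B = ▹-induction _ λ A IH x p P x∈A x∉B →
    trans (pathSum-step a (endAt B) A p P)
      (+-zero (endAt-no A B P (λ { refl → x∉B x∈A }))
        (∑∉-zero A (λ y y∉A → *-zeroʳ′ (edge A p P y) (IH y y∉A x _ _ (A⊆A▹y A y x∈A) x∉B))))

  ∑∉-next-cong : ∀ a a′ B A p P →
    (∀ y → y ∉ A → y ∈ B → next a (endAt B) A p P y ≡ next a′ (endAt B) A p P y) →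
    ∑∉ A (next a (endAt B) A p P) ≡ ∑∉ A (next a′ (endAt B) A p P)
  ∑∉-next-cong a a′ B A p P h = ∑∉-cong A λ y y∉A → go y y∉A (y ∈? B)
    where
    go : ∀ y → y ∉ A → Dec (y ∈ B) → _
    go y y∉A (yes y∈B) = h y y∉A y∈B
    go y y∉A (no  y∉B) = cong (edge A p P y *_)
      (trans (pathsTo-outside a B (A ▹ y) y _ _ (y∈A▹y A y) y∉B) (sym (pathsTo-outside a′ B (A ▹ y) y _ _ (y∈A▹y A y) y∉B)))

  ∑∉-next-zero : ∀ a B A p P → (∀ y → y ∉ A → y ∈ B → next a (endAt B) A p P y ≡ 0ℚ) → ∑∉ A (next a (endAt B) A p P) ≡ 0ℚ
  ∑∉-next-zero a B A p P h = ∑∉-zero A λ y y∉A → go y y∉A (y ∈? B)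
    where
    go : ∀ y → y ∉ A → Dec (y ∈ B) → _
    go y y∉A (yes y∈B) = h y y∉A y∈B
    go y y∉A (no  y∉B) = *-zeroʳ′ (edge A p P y) (pathsTo-outside a B (A ▹ y) y _ _ (y∈A▹y A y) y∉B)

  pathsTo-⊈ : ∀ a B A p P → ¬ (A ⊆ B) → pathsTo a B A p P ≡ 0ℚ
  pathsTo-⊈ a B A p P A⊈B with Fin.any? (λ x → (x ∈? A) ×-dec ¬? (x ∈? B))
  ... | yes (x , x∈A , x∉B) = pathsTo-outside a B A x p P x∈A x∉B
  ... | no ¬∃ = ⊥-elim (A⊈B λ {x} x∈A → decidable-stable (x ∈? B) (λ x∉B → ¬∃ (x , x∈A , x∉B)))

  pathsTo-cong : ∀ a a′ B A p P → (∀ A′ y → A ⊆ A′ → y ∉ A′ → A′ ▹ y ⊆ B → a A′ y ≡ a′ A′ y) →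
                 pathsTo a B A p P ≡ pathsTo a′ B A p P
  pathsTo-cong a a′ B = ▹-induction _ λ A IH p P a≗a′ → go A IH p P a≗a′ (A ⊆? B)
    where
    go : ∀ A → _ → ∀ p P → _ → Dec (A ⊆ B) → pathsTo a B A p P ≡ pathsTo a′ B A p P
    go A IH p P a≗a′ (no A⊈B)  = trans (pathsTo-⊈ a B A p P A⊈B) (sym (pathsTo-⊈ a′ B A p P A⊈B))
    go A IH p P a≗a′ (yes A⊆B) = trans (pathSum-step a _ A p P) (trans
      (cong (endAt B A P +_) (∑∉-next-cong a a′ B A p P λ y y∉A y∈B →
        cong (edge A p P y *_)
          (trans (IH y y∉A _ _ (λ A′ z ⊆A′ → a≗a′ A′ z (⊆A′ ∘ A⊆A▹y A y)))
            (cong (λ c → pathsTo a′ B (A ▹ y) (suc (toℕ y)) (P ℕ.+ c)) (a≗a′ A y ⊆-refl y∉A (▹-⊆ A⊆B y∈B))))))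
      (sym (pathSum-step a′ _ A p P)))

  -- Paths are sorted by the set at which they stop. The height condition is that of `endAt`, so
  -- every class is again a sum over complete words.
  pathSum-by-endpoint : ∀ a (c : Subset m → ℚ) A p P →
    pathSum a (λ H P → c H * ind (suc P ℕ.≟ ∣ H ∣)) A p P ≡ ΣS (λ H → c H * pathsTo a H A p P)
  pathSum-by-endpoint a c = ▹-induction _ λ A IH p P → begin
    pathSum a R A p P
      ≡⟨ pathSum-step a R A p P ⟩
    R A P + ∑∉ A (next a R A p P)
      ≡⟨ cong₂ _+_ (sym (trans (ΣS-single A _ (λ H H≢A → *-zeroʳ′ (c H) (endAt-no A H P (H≢A ∘ sym))))
            (cong (c A *_) (endAt-yes A P))))
          (∑∉-cong A (λ y y∉A → trans (cong (edge A p P y *_) (IH y y∉A _ _)) (trans (sym (∑-*ˡ (allSubsets m) (edge A p P y) _))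
            (∑-cong (allSubsets m) λ H → solve 3 (λ e c t → e :* (c :* t) := c :* (e :* t)) refl (edge A p P y) (c H) _)))) ⟩
    ΣS (λ H → c H * endAt H A P) + ∑∉ A (λ y → ΣS (λ H → c H * next a (endAt H) A p P y))
      ≡⟨ cong (ΣS (λ H → c H * endAt H A P) +_) (trans (∑∉-ΣS A _) (∑-cong (allSubsets m) (λ H → ∑∉-*ˡ A (c H) _))) ⟩
    ΣS (λ H → c H * endAt H A P) + ΣS (λ H → c H * ∑∉ A (next a (endAt H) A p P))
      ≡⟨ sym (∑-+ (allSubsets m) _ _) ⟩
    ΣS (λ H → c H * endAt H A P + c H * ∑∉ A (next a (endAt H) A p P))
      ≡⟨ ∑-cong (allSubsets m) (λ H → trans (sym (*-distribˡ-+ (c H) _ _)) (cong (c H *_) (sym (pathSum-step a (endAt H) A p P)))) ⟩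
    ΣS (λ H → c H * pathsTo a H A p P) ∎
    where
    open ≡-Reasoning
    open +-*-Solver
    R : Subset m → ℕ → ℚ
    R H P = c H * ind (suc P ℕ.≟ ∣ H ∣)

-- Cutting a word at an intermediate set

module _ {m : ℕ} where

  -- Starting with p = 0 and s = 0 gives the first letter an edge of weight 1, as no denominator
  -- precedes it. The empty word never satisfies the closing condition, so `between a A A` is zero.
  between : Step → Subset m → Subset m → ℚ
  between a A B = pathsTo a B A 0 ∣ A ∣

  between-step : ∀ a (B A : Subset m) → between a A B ≡ ∑∉ A (λ y → pathsTo a B (A ▹ y) (suc (toℕ y)) (∣ A ∣ ℕ.+ a A y))
  between-step a B A = trans (pathSum-step a (endAt B) A 0 ∣ A ∣)
    (trans (cong₂ _+_ (*-zeroʳ′ (ind (A ≟ₛ B)) (ind-no (suc ∣ A ∣ ℕ.≟ ∣ A ∣) ℕ.1+n≢n))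
       (∑∉-cong A (λ y _ → trans (cong (_* T y) (edge≡1 y)) (*-identityˡ (T y))))) (+-identityˡ _))
    where
    T : Fin m → ℚ
    T y = pathsTo a B (A ▹ y) (suc (toℕ y)) (∣ A ∣ ℕ.+ a A y)
    edge≡1 : ∀ y → edge A 0 ∣ A ∣ y ≡ 1ℚ
    edge≡1 y with ∣ A ∣ ≤? ∣ A ∣
    ... | yes _ = refl
    ... | no ¬p = ⊥-elim (¬p ℕ.≤-refl)

  -- `a′` is `a` with one more exponent at the letter whose arrival makes `α` true: the numerator is
  -- multiplied by the variable of that letter. With `α` as "more than k elements" the variable is
  -- t_{w(k)}; with `α` as "contains j" it is t_j.
  module Shift (a a′ : Step {m}) (B : Subset m) (α : Subset m → Bool) (αB : α B ≡ true)
               (α-mono : ∀ {A A′} → A ⊆ A′ → α A ≡ true → α A′ ≡ true)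
               (a′≡ : ∀ A y → y ∉ A → bit (α A) ℕ.+ a′ A y ≡ bit (α (A ▹ y)) ℕ.+ a A y) where

    -- `overshoot` collects the uncut words, which under `a` end one below the closing height; `α`
    -- does not occur in it, so it cancels between two choices of `α`. In `cut` the word closes at
    -- `H` and a fresh one runs from `H` to `B`.
    overshoot cut : Subset m → ℕ → ℚ
    overshoot H P = ind (H ≟ₛ B) * ind (suc (suc P) ℕ.≟ ∣ H ∣)
    cut H P = bitℚ (α H) * between a H B * ind (suc P ℕ.≟ ∣ H ∣)

    private
      R : Subset m → ℕ → ℚ
      R H P = overshoot H P + cut H P

      a≡a′ : ∀ A y → y ∉ A → α A ≡ true → a A y ≡ a′ A y
      a≡a′ A y y∉A αA = sym (ℕ.suc-injective (trans (cong (λ b → bit b ℕ.+ a′ A y) (sym αA))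
        (trans (a′≡ A y y∉A) (cong (λ b → bit b ℕ.+ a A y) (α-mono (A⊆A▹y A y) αA)))))

    -- Once `α` holds, every height is raised by one. `ε-suc` replaces each raised edge by the plain
    -- edge plus an indicator: the plain edge continues the telescoping, the indicator cuts the
    -- word.
    shifted : ∀ A p P → pathsTo a′ B A p (bit (α A) ℕ.+ P) ≡ pathSum a R A p P
    shifted = ▹-induction _ step
      where
      open ≡-Reasoning
      open +-*-Solver
      step : ∀ A → (∀ y → y ∉ A → ∀ p P → pathsTo a′ B (A ▹ y) p (bit (α (A ▹ y)) ℕ.+ P) ≡ pathSum a R (A ▹ y) p P) →
             ∀ p P → pathsTo a′ B A p (bit (α A) ℕ.+ P) ≡ pathSum a R A p P
      step A IH p P = begin
        pathsTo a′ B A p (bit (α A) ℕ.+ P)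
          ≡⟨ pathSum-step a′ (endAt B) A p _ ⟩
        endAt B A (bit (α A) ℕ.+ P) + ∑∉ A (next a′ (endAt B) A p (bit (α A) ℕ.+ P))
          ≡⟨ cong (endAt B A (bit (α A) ℕ.+ P) +_) (∑∉-cong A λ y y∉A → cong (edge A p (bit (α A) ℕ.+ P) y *_)
               (trans (cong (pathsTo a′ B (A ▹ y) (suc (toℕ y))) (heights y y∉A)) (IH y y∉A _ _))) ⟩
        endAt B A (bit (α A) ℕ.+ P) + ∑∉ A (λ y → edge A p (bit (α A) ℕ.+ P) y * V y)
          ≡⟨ split (α A) refl ⟩
        R A P + ∑∉ A (λ y → edge A p P y * V y)
          ≡⟨ sym (pathSum-step a R A p P) ⟩
        pathSum a R A p P ∎
        where
        V : Fin m → ℚ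
        V y = pathSum a R (A ▹ y) (suc (toℕ y)) (P ℕ.+ a A y)

        heights : ∀ y → y ∉ A → bit (α A) ℕ.+ P ℕ.+ a′ A y ≡ bit (α (A ▹ y)) ℕ.+ (P ℕ.+ a A y)
        heights y y∉A = trans (shuffle₁ (bit (α A)) P (a′ A y)) (trans (cong (ℕ._+ P) (a′≡ A y y∉A)) (shuffle₂ (bit (α (A ▹ y))) (a A y) P))
          where
          shuffle₁ : ∀ b P c → b ℕ.+ P ℕ.+ c ≡ b ℕ.+ c ℕ.+ P
          shuffle₁ = solve-∀
          shuffle₂ : ∀ b c P → b ℕ.+ c ℕ.+ P ≡ b ℕ.+ (P ℕ.+ c)
          shuffle₂ = solve-∀

        T i : ℚ
        T = between a A B
        i = ind (suc P ℕ.≟ ∣ A ∣)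

        -- Where the indicator is one, the raised height `suc P` is `∣ A ∣`, the starting height of
        -- a fresh word. The induction hypothesis read backwards returns to `a′`, which agrees with
        -- `a` beyond `A`.
        restart : α A ≡ true → i * ∑∉ A V ≡ T * i
        restart αA with suc P ℕ.≟ ∣ A ∣
        ... | no _   = trans (*-zeroˡ (∑∉ A V)) (sym (*-zeroʳ T))
        ... | yes eq = trans (*-identityˡ (∑∉ A V)) (trans (trans (∑∉-cong A V≡) (sym (between-step a B A))) (sym (*-identityʳ T)))
          where
          V≡ : ∀ y → y ∉ A → V y ≡ pathsTo a B (A ▹ y) (suc (toℕ y)) (∣ A ∣ ℕ.+ a A y)
          V≡ y y∉A = trans (sym (IH y y∉A _ _))
            (trans (cong (pathsTo a′ B (A ▹ y) (suc (toℕ y)))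
                (trans (cong (λ b → bit b ℕ.+ (P ℕ.+ a A y)) αA▹y) (cong (ℕ._+ a A y) eq)))
              (sym (pathsTo-cong a a′ B (A ▹ y) _ _ (λ A′ z ⊆A′ z∉A′ _ → a≡a′ A′ z z∉A′ (α-mono ⊆A′ αA▹y)))))
            where
            αA▹y : α (A ▹ y) ≡ true
            αA▹y = α-mono (A⊆A▹y A y) αA

        split : ∀ b → α A ≡ b → endAt B A (bit b ℕ.+ P) + ∑∉ A (λ y → edge A p (bit b ℕ.+ P) y * V y)
                  ≡ overshoot A P + bitℚ b * T * i + ∑∉ A (λ y → edge A p P y * V y)
        split false αA = cong (_+ ∑∉ A (λ y → edge A p P y * V y))
          (trans (endAt-no A B P A≢B) (sym (+-zero (*-zeroˡ′ (ind (suc (suc P) ℕ.≟ ∣ A ∣)) (ind-no (A ≟ₛ B) A≢B))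
            (*-zeroˡ′ i (*-zeroˡ T)))))
          where
          A≢B : A ≢ B
          A≢B refl with trans (sym αA) αB
          ... | ()
        split true αA = begin
          overshoot A P + ∑∉ A (λ y → edge A p (suc P) y * V y)
            ≡⟨ cong (overshoot A P +_) (∑∉-cong A (λ y _ → trans (cong (_* V y) (ε-suc (p ≤? toℕ y) ∣ A ∣ P))
                 (*-distribʳ-+ (V y) (edge A p P y) i))) ⟩
          overshoot A P + ∑∉ A (λ y → edge A p P y * V y + i * V y)
            ≡⟨ cong (overshoot A P +_) (trans (∑∉-+ A _ _) (cong (∑∉ A (λ y → edge A p P y * V y) +_) (trans (∑∉-*ˡ A i V) (restart αA)))) ⟩
          overshoot A P + (∑∉ A (λ y → edge A p P y * V y) + T * i)
            ≡⟨ solve 4 (λ o s t i → o :+ (s :+ t :* i) := o :+ con 1ℚ :* t :* i :+ s) refl (overshoot A P) _ T i ⟩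
          overshoot A P + 1ℚ * T * i + ∑∉ A (λ y → edge A p P y * V y) ∎

    between-shift : ∀ A → α A ≡ false → between a′ A B ≡
      pathSum a overshoot A 0 ∣ A ∣ + ΣS (λ H → bitℚ (α H) * between a H B * between a A H)
    between-shift A αA = trans (cong (λ b → pathsTo a′ B A 0 (bit b ℕ.+ ∣ A ∣)) (sym αA))
      (trans (shifted A 0 ∣ A ∣) (trans (pathSum-+ a overshoot cut A 0 ∣ A ∣)
        (cong (pathSum a overshoot A 0 ∣ A ∣ +_) (pathSum-by-endpoint a (λ H → bitℚ (α H) * between a H B) A 0 ∣ A ∣))))

  -- The two ways of raising the total exponent by one (at position k, or at the
  -- element j) differ by the sum over the intermediate sets at which the path is cut.
  between-difference : ∀ (a aₖ aⱼ : Step {m}) (A B : Subset m) k j → ∣ A ∣ ≤ k → k < ∣ B ∣ → j ∉ A → j ∈ B →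
    (∀ A y → aₖ A y ≡ bit (does (∣ A ∣ ℕ.≟ k)) ℕ.+ a A y) →
    (∀ A y → aⱼ A y ≡ bit (does (y Fin.≟ j)) ℕ.+ a A y) →
    between aₖ A B - between aⱼ A B ≡
    ΣS (λ H → (bitℚ (does (suc k ≤? ∣ H ∣)) - bitℚ (does (j ∈? H))) * (between a A H * between a H B))
  between-difference a aₖ aⱼ A B k j ∣A∣≤k k<∣B∣ j∉A j∈B aₖ≡ aⱼ≡ = begin
    between aₖ A B - between aⱼ A B
      ≡⟨ cong₂ _-_ (K.between-shift A (dec-false (suc k ≤? ∣ A ∣) (ℕ.≤⇒≯ ∣A∣≤k))) (J.between-shift A (dec-false (j ∈? A) j∉A)) ⟩
    (U + ΣS f) - (U + ΣS g)
      ≡⟨ solve 3 (λ u f g → (u :+ f) :- (u :+ g) := f :+ :- g) refl U (ΣS f) (ΣS g) ⟩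
    ΣS f + - ΣS g
      ≡⟨ cong (ΣS f +_) (sym (∑-neg (allSubsets m) g)) ⟩
    ΣS f + ΣS (λ H → - g H)
      ≡⟨ sym (∑-+ (allSubsets m) f (λ H → - g H)) ⟩
    ΣS (λ H → f H + - g H)
      ≡⟨ ∑-cong (allSubsets m) (λ H → solve 4 (λ b c t s → b :* t :* s :+ :- (c :* t :* s) := (b :- c) :* (s :* t)) refl
           (bitℚ (does (suc k ≤? ∣ H ∣))) (bitℚ (does (j ∈? H))) (between a H B) (between a A H)) ⟩
    ΣS (λ H → (bitℚ (does (suc k ≤? ∣ H ∣)) - bitℚ (does (j ∈? H))) * (between a A H * between a H B)) ∎
    where
    open ≡-Reasoning
    open +-*-Solver
    atₖ : ∀ A y → y ∉ A → bit (does (suc k ≤? ∣ A ∣)) ℕ.+ aₖ A y ≡ bit (does (suc k ≤? ∣ A ▹ y ∣)) ℕ.+ a A y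
    atₖ A y y∉A rewrite aₖ≡ A y | ∣▹∣ A y∉A with ℕ.<-cmp ∣ A ∣ k
    ... | tri< l ne _ rewrite dec-false (suc k ≤? ∣ A ∣) (ℕ.<⇒≯ l) | dec-false (∣ A ∣ ℕ.≟ k) ne | dec-false (suc k ≤? suc ∣ A ∣) (λ { (s≤s le) → ℕ.<⇒≱ l le }) = refl
    ... | tri≈ nl eq _ rewrite dec-false (suc k ≤? ∣ A ∣) (λ le → ℕ.<-irrefl (sym eq) le) | dec-true (∣ A ∣ ℕ.≟ k) eq | dec-true (suc k ≤? suc ∣ A ∣) (s≤s (ℕ.≤-reflexive (sym eq))) = refl
    ... | tri> _ ne g rewrite dec-true (suc k ≤? ∣ A ∣) g | dec-false (∣ A ∣ ℕ.≟ k) ne | dec-true (suc k ≤? suc ∣ A ∣) (ℕ.m≤n⇒m≤1+n g) = refl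
    atⱼ : ∀ A y → y ∉ A → bit (does (j ∈? A)) ℕ.+ aⱼ A y ≡ bit (does (j ∈? A ▹ y)) ℕ.+ a A y
    atⱼ A y y∉A rewrite aⱼ≡ A y with y Fin.≟ j
    ... | yes refl rewrite dec-false (j ∈? A) y∉A | dec-true (j ∈? A ▹ j) (y∈A▹y A j) = refl
    ... | no y≢j with j ∈? A
    ... | yes j∈A rewrite dec-true (j ∈? A ▹ y) (A⊆A▹y A y j∈A) = refl
    ... | no j∉A rewrite dec-false (j ∈? A ▹ y) (∉▹ A j∉A (y≢j ∘ sym)) = refl
    module K = Shift a aₖ B (λ H → does (suc k ≤? ∣ H ∣)) (dec-true (suc k ≤? ∣ B ∣) k<∣B∣)
      (λ {A} {A′} A⊆A′ αA → dec-true (suc k ≤? ∣ A′ ∣) (ℕ.≤-trans (does⁻ (suc k ≤? ∣ A ∣) αA) (p⊆q⇒∣p∣≤∣q∣ A⊆A′))) atₖ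
    module J = Shift a aⱼ B (λ H → does (j ∈? H)) (dec-true (j ∈? B) j∈B)
      (λ {A} {A′} A⊆A′ αA → dec-true (j ∈? A′) (A⊆A′ (does⁻ (j ∈? A) αA))) atⱼ
    U : ℚ
    U = pathSum a K.overshoot A 0 ∣ A ∣
    f g : Subset m → ℚ
    f H = bitℚ (does (suc k ≤? ∣ H ∣)) * between a H B * between a A H
    g H = bitℚ (does (j ∈? H)) * between a H B * between a A H

  -- With s ≥ 0 the word cannot stop, and any next letter in `B` would be a descent, which has
  -- nonzero weight only for s < 0.
  pathsTo-stuck : ∀ a (B A : Subset m) p P → ∣ A ∣ ≤ P → (∀ y → y ∉ A → y ∈ B → toℕ y < p) → pathsTo a B A p P ≡ 0ℚ
  pathsTo-stuck a B A p P ∣A∣≤P small = trans (pathSum-step a (endAt B) A p P)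
    (+-zero (*-zeroʳ′ (ind (A ≟ₛ B)) (ind-no (suc P ℕ.≟ ∣ A ∣) (λ eq → ℕ.<-irrefl refl (ℕ.<-≤-trans (ℕ.≤-reflexive eq) ∣A∣≤P))))
      (∑∉-next-zero a B A p P λ y y∉A y∈B → *-zeroˡ′ _ (stuck y (small y y∉A y∈B))))
    where
    stuck : ∀ y → toℕ y < p → edge A p P y ≡ 0ℚ
    stuck y y<p with p ≤? toℕ y | ∣ A ∣ ≤? P
    ... | yes p≤y | _     = ⊥-elim (ℕ.<⇒≱ y<p p≤y)
    ... | no _    | yes _ = refl
    ... | no _    | no ≰P = ⊥-elim (≰P ∣A∣≤P)

  -- j is the smallest variable in the expansion order, so it has no negative exponents.
  pathsTo-max-vanishes : ∀ a B j → (∀ A → 1 ≤ a A j) → j ∈ B → ∀ A p P → j ∉ A →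
    (∀ y → y ∉ A → y ∈ B → toℕ y ≤ toℕ j) → p ≤ toℕ j → pathsTo a B A p P ≡ 0ℚ
  pathsTo-max-vanishes a B j 1≤a j∈B = ▹-induction _ step
    where
    step : ∀ A → (∀ y → y ∉ A → ∀ p P → j ∉ A ▹ y → (∀ z → z ∉ A ▹ y → z ∈ B → toℕ z ≤ toℕ j) → p ≤ toℕ j → pathsTo a B (A ▹ y) p P ≡ 0ℚ) →
           ∀ p P → j ∉ A → (∀ y → y ∉ A → y ∈ B → toℕ y ≤ toℕ j) → p ≤ toℕ j → pathsTo a B A p P ≡ 0ℚ
    step A IH p P j∉A ub p≤j = trans (pathSum-step a (endAt B) A p P)
      (+-zero (endAt-no A B P (λ { refl → j∉A j∈B })) (∑∉-next-zero a B A p P term))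
      where
      term : ∀ y → y ∉ A → y ∈ B → next a (endAt B) A p P y ≡ 0ℚ
      term y y∉A y∈B with y Fin.≟ j
      ... | no y≢j = *-zeroʳ′ (edge A p P y) (IH y y∉A _ _ (∉▹ A j∉A (y≢j ∘ sym))
              (λ z z∉ → ub z (z∉ ∘ A⊆A▹y A y)) (ℕ.≤∧≢⇒< (ub y y∉A y∈B) (y≢j ∘ Fin.toℕ-injective)))
      ... | yes refl with ∣ A ∣ ≤? P
      ... | no _ = *-zeroˡ′ _ (asc (p ≤? toℕ j))
        where
        asc : (X? : Dec (p ≤ toℕ j)) {Y : Set} {¬y : ¬ Y} → ε X? (no ¬y) ≡ 0ℚ
        asc (yes _)  = refl
        asc (no p≰j) = ⊥-elim (p≰j p≤j)
      -- Since `j` has exponent at least one, s is still nonnegative after `j`, while every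
      -- remaining letter is smaller.
      ... | yes ∣A∣≤P = *-zeroʳ′ (ε (p ≤? toℕ j) (yes ∣A∣≤P)) (pathsTo-stuck a B (A ▹ j) (suc (toℕ j)) (P ℕ.+ a A j)
              (ℕ.≤-trans (ℕ.≤-reflexive (trans (∣▹∣ A j∉A) (sym (ℕ.+-comm ∣ A ∣ 1)))) (ℕ.+-mono-≤ ∣A∣≤P (1≤a A)))
              (λ z z∉ z∈B → s≤s (ub z (z∉ ∘ A⊆A▹y A j) z∈B)))

-- Degrees of minors

negOnePow-square : ∀ k → negOnePow k * negOnePow k ≡ 1ℚ
negOnePow-square zero    = refl
negOnePow-square (suc k) = trans (solve 1 (λ x → :- x :* :- x := x :* x) refl (negOnePow k)) (negOnePow-square k)
  where open +-*-Solver

negOnePow-+ : ∀ k l → negOnePow (k ℕ.+ l) ≡ negOnePow k * negOnePow l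
negOnePow-+ zero    l = sym (*-identityˡ _)
negOnePow-+ (suc k) l = trans (cong -_ (negOnePow-+ k l)) (solve 2 (λ x y → :- (x :* y) := :- x :* y) refl (negOnePow k) (negOnePow l))
  where open +-*-Solver

∑∉-pair : {m : ℕ} (A : Subset m) {f : Fin m → ℚ} (u v : Fin m) → u ≢ v → u ∉ A → v ∉ A →
          (∀ y → y ∉ A → y ≢ u → y ≢ v → f y ≡ 0ℚ) → ∑∉ A f ≡ f u + f v
∑∉-pair {m} A {f} u v u≢v u∉A v∉A f≗0 = begin
  ∑∉ A f                        ≡⟨ ∑∉-cong A (λ y _ → decompose y) ⟩
  ∑∉ A (λ y → g y + h y)        ≡⟨ ∑∉-+ A g h ⟩
  ∑∉ A g + ∑∉ A h               ≡⟨ cong₂ _+_ (∑∉-single A u u∉A (λ y _ y≢u → *-zeroˡ′ (f y) (ind-no (y Fin.≟ u) y≢u)))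
                                             (∑∉-single A v v∉A h≗0) ⟩
  g u + h v                     ≡⟨ cong₂ _+_ (trans (cong (_* f u) (ind-yes (u Fin.≟ u) refl)) (*-identityˡ (f u))) h-v ⟩
  f u + f v                     ∎
  where
  open ≡-Reasoning
  g h : Fin m → ℚ
  g y = ind (y Fin.≟ u) * f y
  h y = unless (y Fin.≟ u) (f y)
  decompose : ∀ y → f y ≡ g y + h y
  decompose y with y Fin.≟ u
  ... | yes _ = sym (trans (+-identityʳ (1ℚ * f y)) (*-identityˡ (f y)))
  ... | no _  = sym (trans (cong (_+ f y) (*-zeroˡ (f y))) (+-identityˡ (f y)))
  h≗0 : ∀ y → y ∉ A → y ≢ v → h y ≡ 0ℚ
  h≗0 y y∉A y≢v with y Fin.≟ u
  ... | yes _  = refl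
  ... | no y≢u = f≗0 y y∉A y≢u y≢v
  h-v : h v ≡ f v
  h-v with v Fin.≟ u
  ... | yes v≡u = ⊥-elim (u≢v (sym v≡u))
  ... | no _    = refl

difference-nonempty : {m : ℕ} (A B : Subset m) → ¬ (B ⊆ A) → ∃ λ x → x ∉ A × x ∈ B
difference-nonempty A B B⊈A with Fin.any? (λ x → ¬? (x ∈? A) ×-dec (x ∈? B))
... | yes w = w
... | no ¬∃ = ⊥-elim (B⊈A λ {x} x∈B → decidable-stable (x ∈? A) (λ x∉A → ¬∃ (x , x∉A , x∈B)))

difference-maximum : {m : ℕ} (A B : Subset m) → ¬ (B ⊆ A) →
  ∃ λ j → (j ∉ A × j ∈ B) × (∀ y → y ∉ A × y ∈ B → toℕ y ≤ toℕ j)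
difference-maximum A B B⊈A = maximum (λ x → ¬? (x ∈? A) ×-dec (x ∈? B)) (difference-nonempty A B B⊈A)

edge-asc : {m : ℕ} (A : Subset m) {p P : ℕ} (y : Fin m) → p ≤ toℕ y → ∣ A ∣ ≤ P → edge A p P y ≡ 1ℚ
edge-asc A {p} {P} y p≤y ≤P with p ≤? toℕ y | ∣ A ∣ ≤? P
... | yes _  | yes _ = refl
... | no p≰y | _     = ⊥-elim (p≰y p≤y)
... | yes _  | no ≰P = ⊥-elim (≰P ≤P)

edge-desc : {m : ℕ} (A : Subset m) {p P : ℕ} (y : Fin m) → toℕ y < p → P < ∣ A ∣ → edge A p P y ≡ - 1ℚ
edge-desc A {p} {P} y y<p P< with p ≤? toℕ y | ∣ A ∣ ≤? P
... | no _    | no _  = refl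
... | yes p≤y | _     = ⊥-elim (ℕ.<⇒≱ y<p p≤y)
... | no _    | yes ≤P = ⊥-elim (ℕ.<⇒≱ P< ≤P)

edge-asc-low : {m : ℕ} (A : Subset m) {p P : ℕ} (y : Fin m) → p ≤ toℕ y → P < ∣ A ∣ → edge A p P y ≡ 0ℚ
edge-asc-low A {p} {P} y p≤y P< with p ≤? toℕ y | ∣ A ∣ ≤? P
... | yes _  | no _  = refl
... | no p≰y | _     = ⊥-elim (p≰y p≤y)
... | yes _  | yes ≤P = ⊥-elim (ℕ.<⇒≱ P< ≤P)

edge-desc-high : {m : ℕ} (A : Subset m) {p P : ℕ} (y : Fin m) → toℕ y < p → ∣ A ∣ ≤ P → edge A p P y ≡ 0ℚ
edge-desc-high A {p} {P} y y<p ≤P with p ≤? toℕ y | ∣ A ∣ ≤? P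
... | no _    | yes _ = refl
... | yes p≤y | _     = ⊥-elim (ℕ.<⇒≱ y<p p≤y)
... | no _    | no ≰P = ⊥-elim (≰P ≤P)

parity : {m : ℕ} → Subset m → ℚ
parity A = negOnePow ∣ A ∣

parity-▹ : {m : ℕ} (A : Subset m) {y : Fin m} → y ∉ A → parity (A ▹ y) ≡ - parity A
parity-▹ A y∉A = cong negOnePow (∣▹∣ A y∉A)

count : List ℕ → ℕ → ℕ
count []       i = 0
count (k ∷ ks) i = bit (does (i ℕ.≟ k)) ℕ.+ count ks i

-- Rank, dependence and the sums attached to minors

module _ {m : ℕ} (M : Matroid m) where
  open Matroid M

  rk-▹ : ∀ A y → rk (A ▹ y) ≤ suc (rk A)
  rk-▹ A y = begin
    rk (A ▹ y)                       ≤⟨ ℕ.m≤m+n _ _ ⟩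
    rk (A ▹ y) ℕ.+ rk (A ∩ ⁅ y ⁆)    ≤⟨ rk-sub A ⁅ y ⁆ ⟩
    rk A ℕ.+ rk ⁅ y ⁆                ≤⟨ ℕ.+-monoʳ-≤ (rk A) (ℕ.≤-trans (rk-card ⁅ y ⁆) (ℕ.≤-reflexive (∣⁅x⁆∣≡1 y))) ⟩
    rk A ℕ.+ 1                       ≡⟨ ℕ.+-comm (rk A) 1 ⟩
    suc (rk A)                       ∎
    where open ℕ.≤-Reasoning

  Dependent : Subset m → Fin m → Set
  Dependent A y = rk (A ▹ y) ≡ rk A

  Dependent-mono : ∀ {A A′ y} → A ⊆ A′ → Dependent A y → Dependent A′ y
  Dependent-mono {A} {A′} {y} A⊆A′ dep = ℕ.≤-antisym (ℕ.+-cancelʳ-≤ (rk A) _ _ (begin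
    rk (A′ ▹ y) ℕ.+ rk A                        ≤⟨ ℕ.+-mono-≤ (rk-mono (▹-⊆ (p⊆p∪q (A ▹ y)) (q⊆p∪q A′ (A ▹ y) (y∈A▹y A y))))
                                                              (rk-mono (λ x∈A → x∈p∩q⁺ (A⊆A′ x∈A , A⊆A▹y A y x∈A))) ⟩
    rk (A′ ∪ (A ▹ y)) ℕ.+ rk (A′ ∩ (A ▹ y))     ≤⟨ rk-sub A′ (A ▹ y) ⟩
    rk A′ ℕ.+ rk (A ▹ y)                        ≡⟨ cong (rk A′ ℕ.+_) dep ⟩
    rk A′ ℕ.+ rk A                              ∎)) (rk-mono (A⊆A▹y A′ y))
    where open ℕ.≤-Reasoning

  independent-rk : ∀ A y → ¬ Dependent A y → rk (A ▹ y) ≡ suc (rk A)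
  independent-rk A y ¬dep = ℕ.≤-antisym (rk-▹ A y) (ℕ.≤∧≢⇒< (rk-mono (A⊆A▹y A y)) (¬dep ∘ sym))

  dependent? : ∀ A y → Dec (Dependent A y)
  dependent? A y = rk (A ▹ y) ℕ.≟ rk A

  defect : Step
  defect A y = bit (does (dependent? A y))

  defect-dependent : ∀ {A y} → Dependent A y → defect A y ≡ 1
  defect-dependent {A} {y} dep = cong bit (dec-true (dependent? A y) dep)

  defect-independent : ∀ {A y} → ¬ Dependent A y → defect A y ≡ 0
  defect-independent {A} {y} ¬dep = cong bit (dec-false (dependent? A y) ¬dep)

  defect-rk : ∀ A y → defect A y ℕ.+ rk (A ▹ y) ≡ suc (rk A)
  defect-rk A y with dependent? A y
  ... | yes dep = trans (cong (ℕ._+ rk (A ▹ y)) (defect-dependent dep)) (cong suc dep)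
  ... | no ¬dep = trans (cong (ℕ._+ rk (A ▹ y)) (defect-independent ¬dep)) (independent-rk A y ¬dep)

  -- This is c_i for the next letter `y`: `∣ A ∣` is its position i and `defect` is 1 exactly when i
  -- is not in K(w). Positions are absolute, so both pieces of a cut word keep their original
  -- indices.
  exponent : List ℕ → Step
  exponent ks A y = count ks ∣ A ∣ ℕ.+ defect A y

  -- For `A ⊆ B` the product `sgn A * sgn B` is -1 to the power of the nullity of M|B/A. Written as
  -- a product over the two ends, it is multiplicative across every intermediate set; between `⊥`
  -- and `⊤` the exponent is n - r.
  sgn : Subset m → ℚ
  sgn A = negOnePow (∣ A ∣ ℕ.+ rk A)

  sgn-square : ∀ A → sgn A * sgn A ≡ 1ℚ
  sgn-square A = negOnePow-square (∣ A ∣ ℕ.+ rk A)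

  -- The claimed degree for the minor M|B/A.
  V : List ℕ → Subset m → Subset m → ℚ
  V ks A B = sgn A * sgn B * between (exponent ks) A B

  coefficient : ℕ → Fin m → Subset m → ℚ
  coefficient k j H = bitℚ (does (suc k ≤? ∣ H ∣)) - bitℚ (does (j ∈? H))

  V-⊈ : ∀ ks A B → ¬ (A ⊆ B) → V ks A B ≡ 0ℚ
  V-⊈ ks A B A⊈B = *-zeroʳ′ (sgn A * sgn B) (pathsTo-⊈ (exponent ks) B A 0 ∣ A ∣ A⊈B)

  -- Prefixes of a word from `A` to `B` that are followed by a letter have sizes from `∣ A ∣` to
  -- `∣ B ∣ ∸ 1`; outside this range the letter at position k does not belong to the word.
  V-skip : ∀ k ks A B → ¬ (∣ A ∣ ≤ k × k < ∣ B ∣) → V (k ∷ ks) A B ≡ V ks A B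
  V-skip k ks A B ∉AB = cong (sgn A * sgn B *_) (pathsTo-cong (exponent (k ∷ ks)) (exponent ks) B A 0 ∣ A ∣ λ A′ y A⊆A′ y∉A′ A′▹y⊆B →
    cong (λ b → bit b ℕ.+ count ks ∣ A′ ∣ ℕ.+ defect A′ y) (dec-false (∣ A′ ∣ ℕ.≟ k) λ { refl →
      ∉AB (p⊆q⇒∣p∣≤∣q∣ A⊆A′ , ℕ.≤-trans (ℕ.≤-reflexive (sym (∣▹∣ A′ y∉A′))) (p⊆q⇒∣p∣≤∣q∣ A′▹y⊆B)) }))

  -- With `j` the maximum of B minus A, the term raised at `j` is zero, so the difference formula
  -- computes `V` itself. The choice of `j` depends only on the two ends.
  V-split : ∀ k A B → ∣ A ∣ ≤ k → k < ∣ B ∣ → ∃ λ j → j ∉ A × j ∈ B ×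
            (∀ ks → V (k ∷ ks) A B ≡ ΣS (λ H → coefficient k j H * (V ks A H * V ks H B)))
  V-split k A B ∣A∣≤k k<∣B∣ with difference-maximum A B (λ B⊆A → ℕ.<⇒≱ (ℕ.≤-<-trans ∣A∣≤k k<∣B∣) (p⊆q⇒∣p∣≤∣q∣ B⊆A))
  ... | j , (j∉A , j∈B) , ub = j , j∉A , j∈B , λ ks → begin
    V (k ∷ ks) A B
      ≡⟨ cong (sgn A * sgn B *_) (sym (trans (cong (λ t → between (exponent (k ∷ ks)) A B - t)
            (pathsTo-max-vanishes (aⱼ ks) B j (λ A → ℕ.≤-trans (ℕ.≤-reflexive (sym (cong bit (dec-true (j Fin.≟ j) refl)))) (ℕ.m≤m+n _ (exponent ks A j)))
              j∈B A 0 ∣ A ∣ j∉A (λ y y∉A y∈B → ub y (y∉A , y∈B)) z≤n)) (+-identityʳ _))) ⟩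
    sgn A * sgn B * (between (exponent (k ∷ ks)) A B - between (aⱼ ks) A B)
      ≡⟨ cong (sgn A * sgn B *_) (between-difference (exponent ks) (exponent (k ∷ ks)) (aⱼ ks) A B k j ∣A∣≤k k<∣B∣ j∉A j∈B
            (λ A y → ℕ.+-assoc (bit (does (∣ A ∣ ℕ.≟ k))) _ _) (λ _ _ → refl)) ⟩
    sgn A * sgn B * ΣS (λ H → coefficient k j H * (between (exponent ks) A H * between (exponent ks) H B))
      ≡⟨ sym (∑-*ˡ (allSubsets m) (sgn A * sgn B) _) ⟩
    ΣS (λ H → sgn A * sgn B * (coefficient k j H * (between (exponent ks) A H * between (exponent ks) H B)))
      ≡⟨ ∑-cong (allSubsets m) (λ H → insert-square H (coefficient k j H) (between (exponent ks) A H) (between (exponent ks) H B)) ⟩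
    ΣS (λ H → coefficient k j H * (V ks A H * V ks H B)) ∎
    where
    open ≡-Reasoning
    open +-*-Solver
    aⱼ : List ℕ → Step
    aⱼ ks A y = bit (does (y Fin.≟ j)) ℕ.+ exponent ks A y
    insert-square : ∀ H c s t → sgn A * sgn B * (c * (s * t)) ≡ c * (sgn A * sgn H * s * (sgn H * sgn B * t))
    insert-square H c s t = trans
      (trans (solve 5 (λ a b c s t → a :* b :* (c :* (s :* t)) := con 1ℚ :* (a :* b :* c :* s :* t)) refl (sgn A) (sgn B) c s t)
        (cong (_* (sgn A * sgn B * c * s * t)) (sym (sgn-square H))))
      (solve 6 (λ a b h c s t → h :* h :* (a :* b :* c :* s :* t) := c :* (a :* h :* s :* (h :* b :* t))) refl (sgn A) (sgn B) (sgn H) c s t)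

  -- Minors of rank one, without further factors

  module RankOne (B : Subset m) where

    stays-inside : ∀ {A y} → A ⊆ B → y ∈ B → rk A ≡ rk B → Dependent A y
    stays-inside {A} {y} A⊆B y∈B rkA = ℕ.≤-antisym (ℕ.≤-trans (rk-mono (▹-⊆ A⊆B y∈B)) (ℕ.≤-reflexive (sym rkA))) (rk-mono (A⊆A▹y A y))

    -- Once the rank of `B` is reached every new letter has exponent 1, which keeps s at -1.
    spanned-step : ∀ {A y P} → A ⊆ B → y ∉ A → y ∈ B → rk A ≡ rk B → suc P ≡ ∣ A ∣ → suc (P ℕ.+ defect A y) ≡ ∣ A ▹ y ∣
    spanned-step {A} {y} {P} A⊆B y∉A y∈B rkA eq =
      trans (cong (λ t → suc (P ℕ.+ t)) (defect-dependent (stays-inside A⊆B y∈B rkA)))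
        (trans (cong suc (trans (ℕ.+-comm P 1) eq)) (sym (∣▹∣ A y∉A)))

    -- At s = -1 only descents have nonzero weight, so a missing letter above the last one can never
    -- be reached.
    spanned-ascent : ∀ A p P z → suc P ≡ ∣ A ∣ → A ⊆ B → rk A ≡ rk B → z ∉ A → z ∈ B → p ≤ toℕ z → pathsTo defect B A p P ≡ 0ℚ
    spanned-ascent = ▹-induction _ λ A IH p P z eq A⊆B rkA z∉A z∈B p≤z →
      trans (pathSum-step defect (endAt B) A p P) (+-zero (endAt-no A B P (λ { refl → z∉A z∈B }))
        (∑∉-next-zero defect B A p P λ y y∉A y∈B → term A IH p P z eq A⊆B rkA z∉A z∈B p≤z y y∉A y∈B (p ≤? toℕ y)))
      where
      term : ∀ A → (∀ y → y ∉ A → ∀ p P z → suc P ≡ ∣ A ▹ y ∣ → A ▹ y ⊆ B → rk (A ▹ y) ≡ rk B → z ∉ A ▹ y → z ∈ B → p ≤ toℕ z → pathsTo defect B (A ▹ y) p P ≡ 0ℚ) →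
             ∀ p P z → suc P ≡ ∣ A ∣ → A ⊆ B → rk A ≡ rk B → z ∉ A → z ∈ B → p ≤ toℕ z → ∀ y → y ∉ A → y ∈ B → Dec (p ≤ toℕ y) → next defect (endAt B) A p P y ≡ 0ℚ
      term A IH p P z eq A⊆B rkA z∉A z∈B p≤z y y∉A y∈B (yes p≤y) =
        *-zeroˡ′ (pathsTo defect B (A ▹ y) _ _) (edge-asc-low A y p≤y (ℕ.≤-reflexive eq))
      term A IH p P z eq A⊆B rkA z∉A z∈B p≤z y y∉A y∈B (no p≰y) =
        *-zeroʳ′ (edge A p P y) (IH y y∉A _ _ z (spanned-step A⊆B y∉A y∈B rkA eq) (▹-⊆ A⊆B y∈B)
          (trans (stays-inside A⊆B y∈B rkA) rkA) (∉▹ A z∉A (λ { refl → p≰y p≤z })) z∈B (ℕ.<-≤-trans (ℕ.≰⇒> p≰y) p≤z))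

    -- Only the decreasing order of B minus A survives, and each of its steps contributes -1.
    spanned-descent : ∀ A p P → suc P ≡ ∣ A ∣ → A ⊆ B → rk A ≡ rk B → (∀ y → y ∉ A → y ∈ B → toℕ y < p) →
                      pathsTo defect B A p P ≡ parity A * parity B
    spanned-descent = ▹-induction _ λ A IH p P eq A⊆B rkA small → go A IH p P eq A⊆B rkA small (B ⊆? A)
      where
      go : ∀ A → (∀ y → y ∉ A → ∀ p P → suc P ≡ ∣ A ▹ y ∣ → A ▹ y ⊆ B → rk (A ▹ y) ≡ rk B → (∀ z → z ∉ A ▹ y → z ∈ B → toℕ z < p) → pathsTo defect B (A ▹ y) p P ≡ parity (A ▹ y) * parity B) →
           ∀ p P → suc P ≡ ∣ A ∣ → A ⊆ B → rk A ≡ rk B → (∀ y → y ∉ A → y ∈ B → toℕ y < p) → Dec (B ⊆ A) →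
           pathsTo defect B A p P ≡ parity A * parity B
      go A IH p P eq A⊆B rkA small (yes B⊆A) with ⊆-antisym A⊆B B⊆A
      ... | refl = trans (pathSum-step defect (endAt B) B p P) (trans
        (cong₂ _+_ (trans (endAt-yes B P) (ind-yes (suc P ℕ.≟ ∣ B ∣) eq)) (∑∉-next-zero defect B B p P λ y y∉B y∈B → ⊥-elim (y∉B y∈B)))
        (sym (negOnePow-square ∣ B ∣)))
      go A IH p P eq A⊆B rkA small (no B⊈A) with difference-maximum A B B⊈A
      ... | j , (j∉A , j∈B) , ub = trans (pathSum-step defect (endAt B) A p P) (trans
        (cong₂ _+_ (endAt-no A B P (λ { refl → j∉A j∈B })) (trans (∑∉-single A j j∉A others) (cong₂ _*_ (edge-desc A j (small j j∉A j∈B) (ℕ.≤-reflexive eq)) at-j)))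
        (trans (solve 2 (λ x y → con 0ℚ :+ :- con 1ℚ :* (x :* y) := :- x :* y) refl (parity (A ▹ j)) (parity B))
          (cong (_* parity B) (trans (cong -_ (parity-▹ A j∉A)) (solve 1 (λ x → :- (:- x) := x) refl (parity A))))))
        where
        open +-*-Solver
        at-j : pathsTo defect B (A ▹ j) (suc (toℕ j)) (P ℕ.+ defect A j) ≡ parity (A ▹ j) * parity B
        at-j = IH j j∉A _ _ (spanned-step A⊆B j∉A j∈B rkA eq) (▹-⊆ A⊆B j∈B) (trans (stays-inside A⊆B j∈B rkA) rkA)
          (λ z z∉ z∈B → s≤s (ub z (z∉ ∘ A⊆A▹y A j , z∈B)))
        others : ∀ y → y ∉ A → y ≢ j → next defect (endAt B) A p P y ≡ 0ℚ
        others y y∉A y≢j with y ∈? B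
        ... | no y∉B = *-zeroʳ′ (edge A p P y) (pathsTo-outside defect B (A ▹ y) y _ _ (y∈A▹y A y) y∉B)
        ... | yes y∈B = *-zeroʳ′ (edge A p P y) (spanned-ascent (A ▹ y) _ _ j (spanned-step A⊆B y∉A y∈B rkA eq) (▹-⊆ A⊆B y∈B)
                (trans (stays-inside A⊆B y∈B rkA) rkA) (∉▹ A j∉A (y≢j ∘ sym)) j∈B (ℕ.≤∧≢⇒< (ub y (y∉A , y∈B)) (y≢j ∘ Fin.toℕ-injective)))

    -- The letter that raises the rank has exponent 0 and moves s from 0 to -1.
    jump-height : ∀ {A y} → y ∉ A → ¬ Dependent A y → suc (∣ A ∣ ℕ.+ defect A y) ≡ ∣ A ▹ y ∣
    jump-height {A} {y} y∉A ¬dep = trans (cong suc (trans (cong (∣ A ∣ ℕ.+_) (defect-independent ¬dep)) (ℕ.+-identityʳ _))) (sym (∣▹∣ A y∉A))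

    jump-ascent : ∀ {A p} j y → A ⊆ B → rk B ≡ suc (rk A) → j ∉ A → j ∈ B → toℕ y < toℕ j → y ∉ A → y ∈ B → ¬ Dependent A y →
                  next defect (endAt B) A p ∣ A ∣ y ≡ 0ℚ
    jump-ascent {A} {p} j y A⊆B rkB j∉A j∈B y<j y∉A y∈B ¬dep = *-zeroʳ′ (edge A p ∣ A ∣ y)
      (spanned-ascent (A ▹ y) _ _ j (jump-height y∉A ¬dep) (▹-⊆ A⊆B y∈B) (trans (independent-rk A y ¬dep) (sym rkB))
        (∉▹ A j∉A (λ { refl → ℕ.<-irrefl refl y<j })) j∈B y<j)

    jump-maximum : ∀ {A p} j → A ⊆ B → rk B ≡ suc (rk A) → j ∉ A → j ∈ B → (∀ y → y ∉ A × y ∈ B → toℕ y ≤ toℕ j) → p ≤ toℕ j →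
                   ¬ Dependent A j → next defect (endAt B) A p ∣ A ∣ j ≡ - parity A * parity B
    jump-maximum {A} {p} j A⊆B rkB j∉A j∈B ub p≤j ¬dep = trans
      (cong₂ _*_ (edge-asc A j p≤j ℕ.≤-refl) (spanned-descent (A ▹ j) _ _ (jump-height j∉A ¬dep) (▹-⊆ A⊆B j∈B)
        (trans (independent-rk A j ¬dep) (sym rkB)) (λ z z∉ z∈B → s≤s (ub z (z∉ ∘ A⊆A▹y A j , z∈B)))))
      (trans (*-identityˡ _) (cong (_* parity B) (parity-▹ A j∉A)))

    -- At s = 0 the next letter must ascend; being independent it raises the rank, and only descents
    -- can follow. So the maximum comes first and the rest in decreasing order. Independence is
    -- asked only from `p` on, as smaller letters have weight 0 at s = 0; this is the form available
    -- after the largest loop has been read.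
    no-loops : ∀ A p j → A ⊆ B → rk B ≡ suc (rk A) → j ∉ A → j ∈ B → (∀ y → y ∉ A × y ∈ B → toℕ y ≤ toℕ j) → p ≤ toℕ j →
               (∀ y → y ∉ A → y ∈ B → p ≤ toℕ y → ¬ Dependent A y) →
               pathsTo defect B A p ∣ A ∣ ≡ - parity A * parity B
    no-loops A p j A⊆B rkB j∉A j∈B ub p≤j indep = trans (pathSum-step defect (endAt B) A p ∣ A ∣)
      (trans (cong₂ _+_ (endAt-no A B ∣ A ∣ (λ { refl → j∉A j∈B })) (trans (∑∉-single A j j∉A others)
        (jump-maximum {A} {p} j A⊆B rkB j∉A j∈B ub p≤j (indep j j∉A j∈B p≤j)))) (+-identityˡ _))
      where
      others : ∀ y → y ∉ A → y ≢ j → next defect (endAt B) A p ∣ A ∣ y ≡ 0ℚ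
      others y y∉A y≢j = go (y ∈? B) (p ≤? toℕ y)
        where
        go : Dec (y ∈ B) → Dec (p ≤ toℕ y) → next defect (endAt B) A p ∣ A ∣ y ≡ 0ℚ
        go (no y∉B)  _         = *-zeroʳ′ (edge A p ∣ A ∣ y) (pathsTo-outside defect B (A ▹ y) y _ _ (y∈A▹y A y) y∉B)
        go (yes y∈B) (yes p≤y) = jump-ascent {A} {p} j y A⊆B rkB j∉A j∈B (ℕ.≤∧≢⇒< (ub y (y∉A , y∈B)) (y≢j ∘ Fin.toℕ-injective)) y∉A y∈B (indep y y∉A y∈B p≤y)
        go (yes y∈B) (no p≰y)  = *-zeroˡ′ (pathsTo defect B (A ▹ y) _ _) (edge-desc-high A y (ℕ.≰⇒> p≰y) ℕ.≤-refl)

    LoopVanishing : Subset m → Set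
    LoopVanishing A = ∀ p ℓ → A ⊆ B → rk B ≡ suc (rk A) → ℓ ∉ A → ℓ ∈ B → Dependent A ℓ → p ≤ toℕ ℓ → pathsTo defect B A p ∣ A ∣ ≡ 0ℚ

    loop-height : ∀ {A y} → y ∉ A → Dependent A y → ∣ A ∣ ℕ.+ defect A y ≡ ∣ A ▹ y ∣
    loop-height {A} {y} y∉A dep = trans (cong (∣ A ∣ ℕ.+_) (defect-dependent dep)) (trans (ℕ.+-comm ∣ A ∣ 1) (sym (∣▹∣ A y∉A)))

    -- Only two orderings can survive: the maximum comes first, or the largest loop comes
    -- first and the maximum second; they have opposite signs.
    loop-vanishing : ∀ A → LoopVanishing A
    loop-vanishing = ▹-induction LoopVanishing step
      where
      step : ∀ A → (∀ y → y ∉ A → LoopVanishing (A ▹ y)) → LoopVanishing A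
      step A IH p ℓ A⊆B rkB ℓ∉A ℓ∈B depℓ p≤ℓ
        with maximum (λ x → (¬? (x ∈? A) ×-dec (x ∈? B)) ×-dec dependent? A x) (ℓ , (ℓ∉A , ℓ∈B) , depℓ)
           | difference-maximum A B (λ B⊆A → ℓ∉A (B⊆A ℓ∈B))
      ... | L , ((L∉A , L∈B) , depL) , ubL | j , (j∉A , j∈B) , ub =
        trans (pathSum-step defect (endAt B) A p ∣ A ∣) (+-zero (endAt-no A B ∣ A ∣ (λ { refl → j∉A j∈B })) (total (dependent? A j)))
        where
        p≤L : p ≤ toℕ L
        p≤L = ℕ.≤-trans p≤ℓ (ubL ℓ ((ℓ∉A , ℓ∈B) , depℓ))
        f : Fin m → ℚ
        f = next defect (endAt B) A p ∣ A ∣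
        at-loop : ∀ y → y ∉ A → Dependent A y → f y ≡ edge A p (∣ A ∣) y * pathsTo defect B (A ▹ y) (suc (toℕ y)) (∣ A ▹ y ∣)
        at-loop y y∉A dep = cong (λ P → edge A p ∣ A ∣ y * pathsTo defect B (A ▹ y) (suc (toℕ y)) P) (loop-height y∉A dep)
        others : ∀ y → y ∉ A → y ≢ L → y ≢ j → f y ≡ 0ℚ
        others y y∉A y≢L y≢j = go (y ∈? B) (p ≤? toℕ y) (dependent? A y)
          where
          go : Dec (y ∈ B) → Dec (p ≤ toℕ y) → Dec (Dependent A y) → f y ≡ 0ℚ
          go (no y∉B)  _         _         = *-zeroʳ′ (edge A p ∣ A ∣ y) (pathsTo-outside defect B (A ▹ y) y _ _ (y∈A▹y A y) y∉B)
          go (yes y∈B) (no p≰y)  _         = *-zeroˡ′ (pathsTo defect B (A ▹ y) _ _) (edge-desc-high A y (ℕ.≰⇒> p≰y) ℕ.≤-refl)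
          go (yes y∈B) (yes p≤y) (no ¬dep) = jump-ascent {A} {p} j y A⊆B rkB j∉A j∈B (ℕ.≤∧≢⇒< (ub y (y∉A , y∈B)) (y≢j ∘ Fin.toℕ-injective)) y∉A y∈B ¬dep
          -- A loop below `L` leaves `L` as a larger loop of the next minor, where the induction
          -- hypothesis applies.
          go (yes y∈B) (yes p≤y) (yes dep) = trans (at-loop y y∉A dep) (*-zeroʳ′ (edge A p ∣ A ∣ y) (IH y y∉A _ L (▹-⊆ A⊆B y∈B)
                (trans rkB (cong suc (sym dep))) (∉▹ A L∉A (y≢L ∘ sym)) L∈B (Dependent-mono (A⊆A▹y A y) depL)
                (ℕ.≤∧≢⇒< (ubL y ((y∉A , y∈B) , dep)) (y≢L ∘ Fin.toℕ-injective))))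
        total : Dec (Dependent A j) → ∑∉ A f ≡ 0ℚ
        -- If the maximum is a loop, it is the largest loop, and reading it first leaves s = 0 with
        -- nothing but descents ahead.
        total (yes depj) with Fin.toℕ-injective (ℕ.≤-antisym (ubL j ((j∉A , j∈B) , depj)) (ub L (L∉A , L∈B)))
        ... | refl = trans (∑∉-single A j j∉A (λ y y∉A y≢j → others y y∉A y≢j y≢j)) (trans (at-loop j j∉A depj)
          (*-zeroʳ′ (edge A p ∣ A ∣ j) (pathsTo-stuck defect B (A ▹ j) _ _ ℕ.≤-refl (λ z z∉ z∈B → s≤s (ub z (z∉ ∘ A⊆A▹y A j , z∈B))))))
        total (no ¬depj) = trans (∑∉-pair A L j L≢j L∉A j∉A others) (trans (cong₂ _+_ at-L (jump-maximum {A} {p} j A⊆B rkB j∉A j∈B ub (ℕ.≤-trans p≤L (ℕ.<⇒≤ L<j)) ¬depj))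
          (solve 2 (λ x y → x :* y :+ :- x :* y := con 0ℚ) refl (parity A) (parity B)))
          where
          open +-*-Solver
          L≢j : L ≢ j
          L≢j refl = ¬depj depL
          L<j : toℕ L < toℕ j
          L<j = ℕ.≤∧≢⇒< (ub L (L∉A , L∈B)) (L≢j ∘ Fin.toℕ-injective)
          -- As `L` depends on `A`, a letter depending on `A ▹ L` already depends on `A`, so it
          -- cannot exceed the largest loop.
          indep : ∀ y → y ∉ A ▹ L → y ∈ B → suc (toℕ L) ≤ toℕ y → ¬ Dependent (A ▹ L) y
          indep y y∉ y∈B L<y dep = ℕ.<⇒≱ L<y (ubL y ((y∉ ∘ A⊆A▹y A L , y∈B) , ℕ.≤-antisym
            (ℕ.≤-trans (rk-mono (▹-⊆ (A⊆A▹y (A ▹ L) y ∘ A⊆A▹y A L) (y∈A▹y (A ▹ L) y))) (ℕ.≤-reflexive (trans dep depL))) (rk-mono (A⊆A▹y A y))))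
          at-L : f L ≡ parity A * parity B
          at-L = trans (at-loop L L∉A depL) (trans (cong₂ _*_ (edge-asc A L p≤L ℕ.≤-refl)
            (no-loops (A ▹ L) _ j (▹-⊆ A⊆B L∈B) (trans rkB (cong suc (sym depL))) (∉▹ A j∉A (L≢j ∘ sym)) j∈B
              (λ y (y∉ , y∈B) → ub y (y∉ ∘ A⊆A▹y A L , y∈B)) L<j indep))
            (trans (cong (λ q → 1ℚ * (- q * parity B)) (parity-▹ A L∉A))
              (solve 2 (λ x y → con 1ℚ :* (:- (:- x) :* y) := x :* y) refl (parity A) (parity B))))

  -- P + rk A - ∣A∣ is constant along a path, because each letter raises either the exponent total
  -- or the rank by one. Closing at `B` prescribes its value.
  wrong-rank : ∀ B A p P → suc P ℕ.+ rk A ≢ ∣ A ∣ ℕ.+ rk B → pathsTo defect B A p P ≡ 0ℚ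
  wrong-rank B = ▹-induction _ λ A IH p P ne → trans (pathSum-step defect (endAt B) A p P) (+-zero (end A P ne (A ≟ₛ B))
    (∑∉-zero A λ y y∉A → *-zeroʳ′ (edge A p P y) (IH y y∉A _ _ (λ eq → ne (ℕ.suc-injective
      (trans (heights A P y) (trans eq (cong (ℕ._+ rk B) (∣▹∣ A y∉A)))))))))
    where
    end : ∀ A P → suc P ℕ.+ rk A ≢ ∣ A ∣ ℕ.+ rk B → Dec (A ≡ B) → endAt B A P ≡ 0ℚ
    end A P ne (no A≢B)   = endAt-no A B P A≢B
    end A P ne (yes refl) = *-zeroʳ′ (ind (A ≟ₛ A)) (ind-no (suc P ℕ.≟ ∣ A ∣) (ne ∘ cong (ℕ._+ rk A)))
    heights : ∀ A P y → suc (suc P ℕ.+ rk A) ≡ suc (P ℕ.+ defect A y) ℕ.+ rk (A ▹ y)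
    heights A P y = cong suc (trans (sym (ℕ.+-suc P (rk A))) (trans (cong (P ℕ.+_) (sym (defect-rk A y))) (sym (ℕ.+-assoc P _ _))))

  -- No cut destroys the loop: for `A ⊆ H`, `ℓ` is a loop of M|H/A if it lies in `H`, and of M|B/H
  -- otherwise. Recursion on `ks` thus ends in minors without further factors, where either the rank
  -- is wrong or `RankOne.loop-vanishing` applies.
  V-loop : ∀ ks A B ℓ → ℓ ∉ A → ℓ ∈ B → Dependent A ℓ → V ks A B ≡ 0ℚ
  V-loop [] A B ℓ ℓ∉A ℓ∈B dep = *-zeroʳ′ (sgn A * sgn B) (go (A ⊆? B) (rk B ℕ.≟ suc (rk A)))
    where
    go : Dec (A ⊆ B) → Dec (rk B ≡ suc (rk A)) → between defect A B ≡ 0ℚ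
    go (no A⊈B)  _         = pathsTo-⊈ defect B A 0 ∣ A ∣ A⊈B
    go (yes _)   (no rkB)  = wrong-rank B A 0 ∣ A ∣ (λ eq → rkB (ℕ.+-cancelˡ-≡ ∣ A ∣ _ _ (sym (trans (ℕ.+-suc ∣ A ∣ (rk A)) eq))))
    go (yes A⊆B) (yes rkB) = RankOne.loop-vanishing B A 0 ℓ A⊆B rkB ℓ∉A ℓ∈B dep z≤n
  V-loop (k ∷ ks) A B ℓ ℓ∉A ℓ∈B dep = go ((∣ A ∣ ≤? k) ×-dec (suc k ≤? ∣ B ∣))
    where
    term : ∀ H → Dec (ℓ ∈ H) → Dec (A ⊆ H) → V ks A H * V ks H B ≡ 0ℚ
    term H (yes ℓ∈H) _         = *-zeroˡ′ (V ks H B) (V-loop ks A H ℓ ℓ∉A ℓ∈H dep)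
    term H (no ℓ∉H)  (yes A⊆H) = *-zeroʳ′ (V ks A H) (V-loop ks H B ℓ ℓ∉H ℓ∈B (Dependent-mono A⊆H dep))
    term H (no ℓ∉H)  (no A⊈H)  = *-zeroˡ′ (V ks H B) (V-⊈ ks A H A⊈H)
    go : Dec (∣ A ∣ ≤ k × k < ∣ B ∣) → V (k ∷ ks) A B ≡ 0ℚ
    go (no ∉AB) = trans (V-skip k ks A B ∉AB) (V-loop ks A B ℓ ℓ∉A ℓ∈B dep)
    go (yes (∣A∣≤k , k<∣B∣)) = let (j , _ , _ , split) = V-split k A B ∣A∣≤k k<∣B∣ in
      trans (split ks) (∑-zero (allSubsets m) λ H → *-zeroʳ′ (coefficient k j H) (term H (ℓ ∈? H) (A ⊆? H)))

  -- The sign of the only surviving order is cancelled by `sgn A * sgn B`, in agreement with the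
  -- degree 1 of complete flags.
  V-rank-one : ∀ A B → A ⊆ B → IsFlat M A → rk B ≡ suc (rk A) → V [] A B ≡ 1ℚ
  V-rank-one A B A⊆B flat rkB = let (j , (j∉A , j∈B) , ub) = difference-maximum A B (λ B⊆A → ℕ.<⇒≱ (ℕ.≤-reflexive (sym rkB)) (rk-mono B⊆A)) in begin
    sgn A * sgn B * between defect A B
      ≡⟨ cong (sgn A * sgn B *_) (RankOne.no-loops B A 0 j A⊆B rkB j∉A j∈B ub z≤n (λ y y∉A _ _ dep → ℕ.<-irrefl (sym dep) (flat y y∉A))) ⟩
    sgn A * sgn B * (- parity A * parity B)
      ≡⟨ cong₂ (λ x y → x * y * (- parity A * parity B)) (negOnePow-+ ∣ A ∣ (rk A))
           (trans (negOnePow-+ ∣ B ∣ (rk B)) (cong (λ r → parity B * negOnePow r) rkB)) ⟩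
    parity A * ρ * (parity B * - ρ) * (- parity A * parity B)
      ≡⟨ solve 3 (λ a b r → a :* r :* (b :* :- r) :* (:- a :* b) := a :* a :* (b :* b) :* (r :* r)) refl (parity A) (parity B) ρ ⟩
    parity A * parity A * (parity B * parity B) * (ρ * ρ)
      ≡⟨ cong₂ _*_ (cong₂ _*_ (negOnePow-square ∣ A ∣) (negOnePow-square ∣ B ∣)) (negOnePow-square (rk A)) ⟩
    1ℚ * 1ℚ * 1ℚ ∎
    where
    open ≡-Reasoning
    open +-*-Solver
    ρ : ℚ
    ρ = negOnePow (rk A)

-- The degree map on flags

module _ {m : ℕ} where

  evalProd-cong : ∀ {φ ψ : List (Subset m) → ℚ} Ls → (∀ ms → length ms ≡ length Ls → φ ms ≡ ψ ms) → evalProd φ Ls ≡ evalProd ψ Ls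
  evalProd-cong []       φ≗ψ = φ≗ψ [] refl
  evalProd-cong (L ∷ Ls) φ≗ψ = ∑-cong (allSubsets m) λ S → cong (L S *_) (evalProd-cong Ls λ ms eq → φ≗ψ (S ∷ ms) (cong suc eq))

  evalProd-zero : ∀ {φ : List (Subset m) → ℚ} Ls → (∀ ms → length ms ≡ length Ls → φ ms ≡ 0ℚ) → evalProd φ Ls ≡ 0ℚ
  evalProd-zero []       φ≗0 = φ≗0 [] refl
  evalProd-zero (L ∷ Ls) φ≗0 = ∑-zero (allSubsets m) λ S → *-zeroʳ′ (L S) (evalProd-zero Ls λ ms eq → φ≗0 (S ∷ ms) (cong suc eq))

  -- The linear relations are given on monomials, whereas the sum over `S` stands outside the
  -- expansion of the remaining factors; the interchange brings it inside.
  evalProd-ΣS : ∀ (Φ : Subset m → List (Subset m) → ℚ) (c : Lin m) Ls →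
                ΣS (λ S → c S * evalProd (Φ S) Ls) ≡ evalProd (λ ms → ΣS (λ S → c S * Φ S ms)) Ls
  evalProd-ΣS Φ c []       = refl
  evalProd-ΣS Φ c (L ∷ Ls) = begin
    ΣS (λ S → c S * ΣS (λ T → L T * e S T))       ≡⟨ ∑-cong (allSubsets m) (λ S → sym (∑-*ˡ (allSubsets m) (c S) _)) ⟩
    ΣS (λ S → ΣS (λ T → c S * (L T * e S T)))     ≡⟨ ∑-swap (allSubsets m) (allSubsets m) _ ⟩
    ΣS (λ T → ΣS (λ S → c S * (L T * e S T)))     ≡⟨ ∑-cong (allSubsets m) (λ T → trans
                                                       (∑-cong (allSubsets m) (λ S → solve 3 (λ x y z → x :* (y :* z) := y :* (x :* z)) refl (c S) (L T) (e S T)))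
                                                       (∑-*ˡ (allSubsets m) (L T) _)) ⟩
    ΣS (λ T → L T * ΣS (λ S → c S * e S T))       ≡⟨ ∑-cong (allSubsets m) (λ T → cong (L T *_) (evalProd-ΣS (λ S ms → Φ S (T ∷ ms)) c Ls)) ⟩
    ΣS (λ T → L T * evalProd (λ ms → ΣS (λ S → c S * Φ S (T ∷ ms))) Ls) ∎
    where
    open ≡-Reasoning
    open +-*-Solver
    e : Subset m → Subset m → ℚ
    e S T = evalProd (λ ms → Φ S (T ∷ ms)) Ls

  lookup-∈? : ∀ (S : Subset m) i → lookup S i ≡ does (i ∈? S)
  lookup-∈? S i = go (i ∈? S)
    where
    go : Dec (i ∈ S) → lookup S i ≡ does (i ∈? S)
    go (yes i∈S) = trans ([]=⇒lookup i∈S) (sym (dec-true (i ∈? S) i∈S))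
    go (no i∉S)  = trans (¬-not (λ eq → i∉S (lookup⇒[]= i S eq))) (sym (dec-false (i ∈? S) i∉S))

Λ-coefficient : ∀ n k S → Λ n k S ≡ bitℚ (does (suc k ≤? ∣ S ∣)) - bitℚ (does (Fin.fromℕ n ∈? S))
Λ-coefficient n k S = cong₂ _-_ (bit≡ (suc k ≤ᵇ ∣ S ∣)) (trans (bit≡ (lookup S (Fin.fromℕ n))) (cong bitℚ (lookup-∈? S (Fin.fromℕ n))))
  where
  bit≡ : ∀ b → ℕtoℚ (if b then 1 else 0) ≡ bitℚ b
  bit≡ true  = refl
  bit≡ false = refl

module _ {m : ℕ} (M : Matroid m) where
  open Matroid M

  -- `⊥` and `⊤` index no generators, so the ends of a chain stay outside the list: the lower end is
  -- a parameter and the upper end is always `⊤`.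
  Flag : Subset m → List (Subset m) → Set
  Flag A []       = A ≢ ⊤
  Flag A (C ∷ Cs) = A ⊆ C × A ≢ C × IsFlat M C × Flag C Cs

  top : List (Subset m) → Subset m
  top []      = ⊤
  top (Q ∷ _) = Q

  last : Subset m → List (Subset m) → Subset m
  last A []       = A
  last A (P ∷ Ps) = last P Ps

  rk-⊥ : rk ⊥ ≡ 0
  rk-⊥ = ℕ.n≤0⇒n≡0 (ℕ.≤-trans (rk-card ⊥) (ℕ.≤-reflexive (∣⊥∣≡0 m)))

  ⊊-nonempty : ∀ {A C : Subset m} → A ⊆ C → A ≢ C → Nonempty C
  ⊊-nonempty {A} {C} A⊆C A≢C = let (x , _ , x∈C) = difference-nonempty A C (A≢C ∘ ⊆-antisym A⊆C) in x , x∈C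

  flag-≢⊤ : ∀ A Cs → Flag A Cs → A ≢ ⊤
  flag-≢⊤ A []       A≢⊤ = A≢⊤
  flag-≢⊤ A (C ∷ Cs) (A⊆C , A≢C , _) refl = A≢C (⊆-antisym A⊆C ⊆⊤)

  flag-member : ∀ A Cs {X} → Flag A Cs → X List.∈ Cs → IsNPFlat M X
  flag-member A (C ∷ Cs) (A⊆C , A≢C , flat , rest) (here refl) = ⊊-nonempty A⊆C A≢C , flag-≢⊤ C Cs rest , flat
  flag-member A (C ∷ Cs) (_ , _ , _ , rest) (there X∈) = flag-member C Cs rest X∈

  flag-drop : ∀ A Ps Qs → Flag A (Ps ++ Qs) → Flag (last A Ps) Qs
  flag-drop A []       Qs flag               = flag
  flag-drop A (P ∷ Ps) Qs (_ , _ , _ , rest) = flag-drop P Ps Qs rest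

  flag-insert : ∀ A Ps Qs S → Flag A (Ps ++ Qs) → last A Ps ⊆ S → last A Ps ≢ S → IsFlat M S → S ⊆ top Qs → S ≢ top Qs → Flag A (Ps ++ S ∷ Qs)
  flag-insert A [] []       S _ A⊆S A≢S flat S⊆ S≢ = A⊆S , A≢S , flat , S≢
  flag-insert A [] (Q ∷ Qs) S (_ , _ , flatQ , rest) A⊆S A≢S flat S⊆ S≢ = A⊆S , A≢S , flat , S⊆ , S≢ , flatQ , rest
  flag-insert A (P ∷ Ps) Qs S (A⊆P , A≢P , flatP , rest) A⊆S A≢S flat S⊆ S≢ =
    A⊆P , A≢P , flatP , flag-insert P Ps Qs S rest A⊆S A≢S flat S⊆ S≢

  last-member : ∀ A Ps → last A Ps ≡ A ⊎ last A Ps List.∈ Ps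
  last-member A []       = inj₁ refl
  last-member A (P ∷ Ps) with last-member P Ps
  ... | inj₁ eq = inj₂ (here eq)
  ... | inj₂ ∈Ps = inj₂ (there ∈Ps)

  top-member : ∀ Qs → top Qs ≡ ⊤ ⊎ top Qs List.∈ Qs
  top-member []       = inj₁ refl
  top-member (Q ∷ Qs) = inj₂ (here refl)

  ⊆-last : ∀ A Ps Qs → Flag A (Ps ++ Qs) → A ⊆ last A Ps
  ⊆-last A []       Qs flag               = ⊆-refl
  ⊆-last A (P ∷ Ps) Qs (A⊆P , _ , _ , rest) = ⊆-last P Ps Qs rest ∘ A⊆P

  locate : ∀ k A Cs → Flag A Cs → ∣ A ∣ ≤ k → k < m → ∃₂ λ Ps Qs → Cs ≡ Ps ++ Qs × ∣ last A Ps ∣ ≤ k × k < ∣ top Qs ∣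
  locate k A []       flag ∣A∣≤k k<m = [] , [] , refl , ∣A∣≤k , ℕ.<-≤-trans k<m (ℕ.≤-reflexive (sym (∣⊤∣≡n m)))
  locate k A (C ∷ Cs) (_ , _ , _ , rest) ∣A∣≤k k<m with ∣ C ∣ ≤? k
  ... | no ∣C∣≰k = [] , C ∷ Cs , refl , ∣A∣≤k , ℕ.≰⇒> ∣C∣≰k
  ... | yes ∣C∣≤k with locate k C Cs rest ∣C∣≤k k<m
  ... | Ps , Qs , refl , lo , hi = C ∷ Ps , Qs , refl , lo , hi

  flat-or-loop : ∀ F → IsFlat M F ⊎ ∃ λ x → x ∉ F × Dependent M F x
  flat-or-loop F with Fin.any? (λ x → ¬? (x ∈? F) ×-dec dependent? M F x)
  ... | yes loop = inj₂ loop
  ... | no ¬loop = inj₁ λ x x∉F → ℕ.≤∧≢⇒< (rk-mono (A⊆A▹y F x)) (λ eq → ¬loop (x , x∉F , sym eq))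

  loop⇒¬flat : ∀ {F x} → x ∉ F → Dependent M F x → ¬ IsFlat M F
  loop⇒¬flat {F} {x} x∉F dep flat = ℕ.<-irrefl (sym dep) (flat x x∉F)

  NPFlat? : ∀ F → Dec (IsNPFlat M F)
  NPFlat? F with nonempty? F | F ≟ₛ ⊤ | flat-or-loop F
  ... | no empty | _      | _         = no λ (ne , _) → empty ne
  ... | yes ne   | yes eq | _         = no λ (_ , F≢⊤ , _) → F≢⊤ eq
  ... | yes ne   | no F≢⊤ | inj₁ flat = yes (ne , F≢⊤ , flat)
  ... | yes ne   | no F≢⊤ | inj₂ (x , x∉F , dep) = no λ (_ , _ , flat) → loop⇒¬flat x∉F dep flat

  flat-rk-< : ∀ {A C} → IsFlat M A → A ⊆ C → A ≢ C → rk A < rk C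
  flat-rk-< {A} {C} flat A⊆C A≢C = let (x , x∉A , x∈C) = difference-nonempty A C (A≢C ∘ ⊆-antisym A⊆C) in
    ℕ.<-≤-trans (flat x x∉A) (rk-mono (▹-⊆ A⊆C x∈C))

  flag-length : ∀ A Cs → IsFlat M A → Flag A Cs → length Cs ℕ.+ suc (rk A) ≤ rk ⊤
  flag-length A []       flat A≢⊤ = flat-rk-< flat ⊆⊤ A≢⊤
  flag-length A (C ∷ Cs) flat (A⊆C , A≢C , flatC , rest) = ℕ.≤-trans
    (ℕ.≤-trans (ℕ.≤-reflexive (sym (ℕ.+-suc (length Cs) (suc (rk A))))) (ℕ.+-monoʳ-≤ (length Cs) (s≤s (flat-rk-< flat A⊆C A≢C))))
    (flag-length C Cs flatC rest)

  -- Every step of a strict chain of flats raises the rank, so a chain of the greatest possible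
  -- length has no room for a step of two.
  flag-rank : ∀ A C Cs → IsFlat M A → Flag A (C ∷ Cs) → length (C ∷ Cs) ℕ.+ suc (rk A) ≡ rk ⊤ → rk C ≡ suc (rk A)
  flag-rank A C Cs flat (A⊆C , A≢C , flatC , rest) eq = ℕ.≤-antisym
    (ℕ.≤-pred (ℕ.+-cancelˡ-≤ (length Cs) _ _ (ℕ.≤-trans (flag-length C Cs flatC rest)
      (ℕ.≤-reflexive (trans (sym eq) (sym (ℕ.+-suc (length Cs) (suc (rk A)))))))))
    (flat-rk-< flat A⊆C A≢C)

  flag-tail : ∀ A C Cs → IsFlat M A → Flag A (C ∷ Cs) → length (C ∷ Cs) ℕ.+ suc (rk A) ≡ rk ⊤ → length Cs ℕ.+ suc (rk C) ≡ rk ⊤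
  flag-tail A C Cs flat flag eq = trans (cong (λ k → length Cs ℕ.+ suc k) (flag-rank A C Cs flat flag eq)) (trans (ℕ.+-suc (length Cs) (suc (rk A))) eq)

  flag-⊆ : ∀ A Cs → Flag A Cs → All (A ⊆_) Cs
  flag-⊆ A []       _ = []
  flag-⊆ A (C ∷ Cs) (A⊆C , _ , _ , rest) = A⊆C ∷ All.map {P = C ⊆_} {Q = A ⊆_} (λ C⊆X x∈A → C⊆X (A⊆C x∈A)) (flag-⊆ C Cs rest)

  flag-complete : ∀ A Cs → IsFlat M A → Flag A Cs → length Cs ℕ.+ suc (rk A) ≡ rk ⊤ → FlagFrom M (rk A) Cs
  flag-complete A []       flat flag eq = tt
  flag-complete A (C ∷ Cs) flat flag@(_ , _ , flatC , rest) eq =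
    flatC , flag-rank A C Cs flat flag eq , flag-⊆ C Cs rest ,
    subst (λ k → FlagFrom M k Cs) (flag-rank A C Cs flat flag eq) (flag-complete C Cs flatC rest (flag-tail A C Cs flat flag eq))

  -- Counterpart of the fact that, after multiplication by the generators of a chain, the degree
  -- splits into degrees of the minors between consecutive members.
  flagProduct : List ℕ → Subset m → List (Subset m) → ℚ
  flagProduct ks A []       = V M ks A ⊤
  flagProduct ks A (C ∷ Cs) = V M ks A C * flagProduct ks C Cs

  below : List ℕ → Subset m → List (Subset m) → ℚ
  below ks A []       = 1ℚ
  below ks A (P ∷ Ps) = V M ks A P * below ks P Ps

  above : List ℕ → List (Subset m) → ℚ
  above ks []       = 1ℚ
  above ks (Q ∷ Qs) = flagProduct ks Q Qs

  flagProduct-top : ∀ ks A Qs → flagProduct ks A Qs ≡ V M ks A (top Qs) * above ks Qs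
  flagProduct-top ks A []       = sym (*-identityʳ (V M ks A ⊤))
  flagProduct-top ks A (Q ∷ Qs) = refl

  flagProduct-++ : ∀ ks A Ps Qs → flagProduct ks A (Ps ++ Qs) ≡ below ks A Ps * flagProduct ks (last A Ps) Qs
  flagProduct-++ ks A []       Qs = sym (*-identityˡ (flagProduct ks A Qs))
  flagProduct-++ ks A (P ∷ Ps) Qs = trans (cong (V M ks A P *_) (flagProduct-++ ks P Ps Qs)) (sym (*-assoc (V M ks A P) (below ks P Ps) _))

  below-skip : ∀ k ks A Ps Qs → Flag A (Ps ++ Qs) → ∣ last A Ps ∣ ≤ k → below (k ∷ ks) A Ps ≡ below ks A Ps
  below-skip k ks A []       Qs flag le = refl
  below-skip k ks A (P ∷ Ps) Qs (_ , _ , _ , rest) le = cong₂ _*_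
    (V-skip M k ks A P (λ (_ , k<P) → ℕ.<⇒≱ k<P (ℕ.≤-trans (p⊆q⇒∣p∣≤∣q∣ (⊆-last P Ps Qs rest)) le))) (below-skip k ks P Ps Qs rest le)

  flagProduct-skip : ∀ k ks A Cs → Flag A Cs → k < ∣ A ∣ → flagProduct (k ∷ ks) A Cs ≡ flagProduct ks A Cs
  flagProduct-skip k ks A []       flag k<A = V-skip M k ks A ⊤ (λ (A≤k , _) → ℕ.<⇒≱ k<A A≤k)
  flagProduct-skip k ks A (C ∷ Cs) (A⊆C , _ , _ , rest) k<A = cong₂ _*_
    (V-skip M k ks A C (λ (A≤k , _) → ℕ.<⇒≱ k<A A≤k)) (flagProduct-skip k ks C Cs rest (ℕ.<-≤-trans k<A (p⊆q⇒∣p∣≤∣q∣ A⊆C)))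

  above-skip : ∀ k ks A Qs → Flag A Qs → k < ∣ top Qs ∣ → above (k ∷ ks) Qs ≡ above ks Qs
  above-skip k ks A []       flag k<top = refl
  above-skip k ks A (Q ∷ Qs) (_ , _ , _ , rest) k<top = flagProduct-skip k ks Q Qs rest k<top

  flagProduct-complete : ∀ A Cs → IsFlat M A → Flag A Cs → length Cs ℕ.+ suc (rk A) ≡ rk ⊤ → flagProduct [] A Cs ≡ 1ℚ
  flagProduct-complete A []       flat flag eq = V-rank-one M A ⊤ ⊆⊤ flat (sym eq)
  flagProduct-complete A (C ∷ Cs) flat flag@(A⊆C , _ , flatC , rest) eq = cong₂ _*_
    (V-rank-one M A C A⊆C flat (flag-rank A C Cs flat flag eq)) (flagProduct-complete C Cs flatC rest (flag-tail A C Cs flat flag eq))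

-- Evaluating the degree map one factor at a time

module Degree {n r : ℕ} (M : Matroid (suc n)) (loopless : Loopless M) (rank : Matroid.rk M ⊤ ≡ suc r)
              (φ : List (Subset (suc n)) → ℚ) (isDegree : IsDegreeMap M r φ) where
  open Matroid M
  open IsDegreeMap isDegree

  module _ (C : List (Subset (suc n))) (Ls : List (Lin (suc n))) (len : length C ℕ.+ suc (length Ls) ≡ r) where

    atGenerator : Subset (suc n) → ℚ
    atGenerator S = evalProd (λ ms → φ (C ++ S ∷ ms)) Ls

    len′ : ∀ S ms → length ms ≡ length Ls → length (C ++ S ∷ ms) ≡ r
    len′ S ms eq = trans (length-++ C) (trans (cong (λ l → length C ℕ.+ suc l) eq) len)

    containing : ∀ i → ΣS (λ S → bitℚ (does (i ∈? S)) * atGenerator S) ≡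
                 evalProd (λ ms → ΣS (λ S → if lookup S i then φ (S ∷ C ++ ms) else 0ℚ)) Ls
    containing i = trans (evalProd-ΣS (λ S ms → φ (C ++ S ∷ ms)) (λ S → bitℚ (does (i ∈? S))) Ls)
      (evalProd-cong Ls λ ms eq → ∑-cong (allSubsets (suc n)) λ S → trans
        (cong₂ (λ b q → bitℚ b * q) (sym (lookup-∈? S i)) (symm _ _ (len′ S ms eq) (shift S C ms)))
        (bitℚ-* (lookup S i) (φ (S ∷ C ++ ms))))
      where
      bitℚ-* : ∀ b q → bitℚ b * q ≡ (if b then q else 0ℚ)
      bitℚ-* true  q = *-identityˡ q
      bitℚ-* false q = *-zeroˡ q

    containing-≡ : ∀ i j → ΣS (λ S → bitℚ (does (i ∈? S)) * atGenerator S) ≡ ΣS (λ S → bitℚ (does (j ∈? S)) * atGenerator S)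
    containing-≡ i j = trans (containing i) (trans
      (evalProd-cong Ls λ ms eq → linear i j (C ++ ms) (trans (cong suc (trans (length-++ C) (cong (length C ℕ.+_) eq))) (trans (sym (ℕ.+-suc (length C) (length Ls))) len)))
      (sym (containing j)))

    -- The element n in the definition of `Λ` is a mere choice: exchanging it for `j` changes the
    -- form by a linear relation. This frees `j` to be taken from the interval being refined.
    change-element : ∀ k j → ΣS (λ S → Λ n k S * atGenerator S) ≡ ΣS (λ S → coefficient M k j S * atGenerator S)
    change-element k j = begin
      ΣS (λ S → Λ n k S * atGenerator S)
        ≡⟨ ∑-cong (allSubsets (suc n)) (λ S → cong (_* atGenerator S) (Λ-coefficient n k S)) ⟩
      ΣS (λ S → coefficient M k (Fin.fromℕ n) S * atGenerator S)
        ≡⟨ expand (Fin.fromℕ n) ⟩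
      K + - J (Fin.fromℕ n)
        ≡⟨ cong (λ q → K + - q) (containing-≡ (Fin.fromℕ n) j) ⟩
      K + - J j
        ≡⟨ sym (expand j) ⟩
      ΣS (λ S → coefficient M k j S * atGenerator S) ∎
      where
      open ≡-Reasoning
      open +-*-Solver
      K : ℚ
      K = ΣS (λ S → bitℚ (does (suc k ≤? ∣ S ∣)) * atGenerator S)
      J : Fin (suc n) → ℚ
      J j = ΣS (λ S → bitℚ (does (j ∈? S)) * atGenerator S)
      expand : ∀ j → ΣS (λ S → coefficient M k j S * atGenerator S) ≡ K + - J j
      expand j = trans (∑-cong (allSubsets (suc n)) (λ S → solve 3 (λ a b g → (a :- b) :* g := a :* g :+ :- (b :* g)) refl
          (bitℚ (does (suc k ≤? ∣ S ∣))) (bitℚ (does (j ∈? S))) (atGenerator S)))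
        (trans (∑-+ (allSubsets (suc n)) _ _) (cong (K +_) (∑-neg (allSubsets (suc n)) _)))

    atGenerator-nonflat : ∀ S → ¬ IsNPFlat M S → atGenerator S ≡ 0ℚ
    atGenerator-nonflat S ¬flat = evalProd-zero Ls λ ms eq → nonflat _ (len′ S ms eq) S (∈-insert C) ¬flat

    atGenerator-incomparable : ∀ {X} S → X List.∈ C → IsNPFlat M X → ¬ (X ⊆ S) → ¬ (S ⊆ X) → atGenerator S ≡ 0ℚ
    atGenerator-incomparable {X} S X∈C flatX X⊈S S⊈X = go (NPFlat? M S)
      where
      go : Dec (IsNPFlat M S) → atGenerator S ≡ 0ℚ
      go (no ¬flat) = atGenerator-nonflat S ¬flat
      go (yes flat) = evalProd-zero Ls λ ms eq → let (ys , zs , C≡) = ∈-∃++ X∈C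
                                                     perm = ↭-trans (shift S C ms) (↭-trans (prep S (++⁺ʳ ms (subst (_↭ X ∷ ys ++ zs) (sym C≡) (shift X ys zs)))) (swap S X ↭-refl)) in
        trans (symm _ _ (len′ S ms eq) perm)
          (incomp X S ((ys ++ zs) ++ ms) (trans (sym (↭-length perm)) (len′ S ms eq)) flatX flat X⊈S S⊈X)

  -- Looplessness enters here: it makes the lowest interval of a complete flag free of loops, so
  -- that its value is 1.
  ⊥-flat : IsFlat M ⊥
  ⊥-flat x _ = ℕ.<-≤-trans (ℕ.≤-reflexive (trans (cong suc (rk-⊥ M)) (sym (loopless x)))) (rk-mono ⊆▹)
    where
    ⊆▹ : ⁅ x ⁆ ⊆ ⊥ ▹ x
    ⊆▹ {z} z∈ = subst (_∈ ⊥ ▹ x) (sym (x∈⁅y⁆⇒x≡y x z∈)) (y∈A▹y ⊥ x)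

  -- Expanding one factor lengthens the chain, so the claim is made for all chains and proved by
  -- recursion on the remaining factors. When none is left, the chain is complete and both sides are
  -- 1.
  degree-flag : ∀ ks C → All (_< suc n) ks → Flag M ⊥ C → length C ℕ.+ length ks ≡ r →
                evalProd (λ ms → φ (C ++ ms)) (map (Λ n) ks) ≡ flagProduct M ks ⊥ C
  degree-flag [] C _ flg len = trans (trans (cong φ (++-identityʳ C)) (flag C len₀ complete)) (sym (flagProduct-complete M ⊥ C ⊥-flat flg full))
    where
    len₀ : length C ≡ r
    len₀ = trans (sym (ℕ.+-identityʳ (length C))) len
    full : length C ℕ.+ suc (rk ⊥) ≡ rk ⊤
    full = trans (cong (λ k → length C ℕ.+ suc k) (rk-⊥ M)) (trans (ℕ.+-comm (length C) 1) (trans (cong suc len₀) (sym rank)))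
    complete : IsCompleteFlag M C
    complete = subst (λ k → FlagFrom M k C) (rk-⊥ M) (flag-complete M ⊥ C ⊥-flat flg full)
  degree-flag (k ∷ ks) C (k<n ∷ <n) flg len = step (locate M k ⊥ C flg (ℕ.≤-trans (ℕ.≤-reflexive (∣⊥∣≡0 (suc n))) z≤n) k<n)
    where
    Ls = map (Λ n) ks
    len₁ : length C ℕ.+ suc (length Ls) ≡ r
    len₁ = trans (cong (λ l → length C ℕ.+ suc l) (length-map (Λ n) ks)) len
    step : (∃₂ λ Ps Qs → C ≡ Ps ++ Qs × ∣ last M ⊥ Ps ∣ ≤ k × k < ∣ top M Qs ∣) →
           evalProd (λ ms → φ (C ++ ms)) (Λ n k ∷ Ls) ≡ flagProduct M (k ∷ ks) ⊥ C
    step (Ps , Qs , C≡ , lo , hi) = trans (change-element C Ls len₁ k j) (trans (∑-cong (allSubsets (suc n)) term) collect)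
      where
      A B : Subset (suc n)
      A = last M ⊥ Ps
      B = top M Qs
      flg′ : Flag M ⊥ (Ps ++ Qs)
      flg′ = subst (Flag M ⊥) C≡ flg
      cut = V-split M k A B lo hi
      j : Fin (suc n)
      j = proj₁ cut
      j∉A : j ∉ A
      j∉A = proj₁ (proj₂ cut)
      j∈B : j ∈ B
      j∈B = proj₁ (proj₂ (proj₂ cut))
      g : Subset (suc n) → ℚ
      g = atGenerator C Ls len₁
      h : Subset (suc n) → ℚ
      h S = below M ks ⊥ Ps * (V M ks A S * V M ks S B) * above M ks Qs
      c : Subset (suc n) → ℚ
      c = coefficient M k j

      -- The two conditions "more than k elements" and "contains j" both fail below `A` and both
      -- hold above `B`; this confines the expansion to the interval.
      c-low : ∀ S → S ⊆ A → c S ≡ 0ℚ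
      c-low S S⊆A = cong₂ (λ a b → bitℚ a - bitℚ b) (dec-false (suc k ≤? ∣ S ∣) (λ k<S → ℕ.<⇒≱ k<S (ℕ.≤-trans (p⊆q⇒∣p∣≤∣q∣ S⊆A) lo)))
        (dec-false (j ∈? S) (j∉A ∘ S⊆A))
      c-high : ∀ S → B ⊆ S → c S ≡ 0ℚ
      c-high S B⊆S = cong₂ (λ a b → bitℚ a - bitℚ b) (dec-true (suc k ≤? ∣ S ∣) (ℕ.<-≤-trans hi (p⊆q⇒∣p∣≤∣q∣ B⊆S))) (dec-true (j ∈? S) (B⊆S j∈B))

      both-zero : ∀ S → c S ≡ 0ℚ ⊎ g S ≡ 0ℚ → h S ≡ 0ℚ → c S * g S ≡ c S * h S
      both-zero S (inj₁ cS≡0) hS≡0 = trans (*-zeroˡ′ (g S) cS≡0) (sym (*-zeroʳ′ (c S) hS≡0))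
      both-zero S (inj₂ gS≡0) hS≡0 = cong (c S *_) (trans gS≡0 (sym hS≡0))
      zero-at : ∀ S → c S ≡ 0ℚ → c S * g S ≡ c S * h S
      zero-at S cS≡0 = trans (*-zeroˡ′ (g S) cS≡0) (sym (*-zeroˡ′ (h S) cS≡0))
      h-zero : ∀ S → V M ks A S * V M ks S B ≡ 0ℚ → h S ≡ 0ℚ
      h-zero S eq = *-zeroˡ′ (above M ks Qs) (*-zeroʳ′ (below M ks ⊥ Ps) eq)

      -- `A` can be missing from the chain only as `⊥`, which lies in every `S`. Dually, `B` can be
      -- missing only as `⊤`.
      A-member : ∀ S → ¬ (A ⊆ S) → A List.∈ C
      A-member S A⊈S with last-member M ⊥ Ps
      ... | inj₁ eq = ⊥-elim (A⊈S (λ x∈A → ⊥-elim (∉⊥ (subst (_ ∈_) eq x∈A))))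
      ... | inj₂ ∈Ps = subst (A List.∈_) (sym C≡) (∈-++⁺ˡ ∈Ps)
      B-member : ∀ S → ¬ (S ⊆ B) → B List.∈ C
      B-member S S⊈B with top-member M Qs
      ... | inj₁ eq = ⊥-elim (S⊈B (λ _ → subst (_ ∈_) (sym eq) ∈⊤))
      ... | inj₂ ∈Qs = subst (B List.∈_) (sym C≡) (∈-++⁺ʳ Ps ∈Qs)
      B-flat : ∀ x → x ∉ B → ¬ Dependent M B x
      B-flat x x∉B dep = loop⇒¬flat M x∉B dep (proj₂ (proj₂ (flag-member M ⊥ C flg (B-member ⁅ x ⁆ (λ ⊆B → x∉B (⊆B (x∈⁅x⁆ x)))))))

      term : ∀ S → c S * g S ≡ c S * h S
      term S = cases (A ⊆? S) (S ⊆? B) (A ≟ₛ S) (S ≟ₛ B) (flat-or-loop M S)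
        where
        cases : Dec (A ⊆ S) → Dec (S ⊆ B) → Dec (A ≡ S) → Dec (S ≡ B) → IsFlat M S ⊎ (∃ λ x → x ∉ S × Dependent M S x) → c S * g S ≡ c S * h S
        cases (no A⊈S) _ _ _ _ = both-zero S (low (S ⊆? A)) (h-zero S (*-zeroˡ′ (V M ks S B) (V-⊈ M ks A S A⊈S)))
          where
          low : Dec (S ⊆ A) → c S ≡ 0ℚ ⊎ g S ≡ 0ℚ
          low (yes S⊆A) = inj₁ (c-low S S⊆A)
          low (no S⊈A)  = inj₂ (atGenerator-incomparable C Ls len₁ S (A-member S A⊈S) (flag-member M ⊥ C flg (A-member S A⊈S)) A⊈S S⊈A)
        cases (yes _) (no S⊈B) _ _ _ = both-zero S (high (B ⊆? S)) (h-zero S (*-zeroʳ′ (V M ks A S) (V-⊈ M ks S B S⊈B)))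
          where
          high : Dec (B ⊆ S) → c S ≡ 0ℚ ⊎ g S ≡ 0ℚ
          high (yes B⊆S) = inj₁ (c-high S B⊆S)
          high (no B⊈S)  = inj₂ (atGenerator-incomparable C Ls len₁ S (B-member S S⊈B) (flag-member M ⊥ C flg (B-member S S⊈B)) B⊈S S⊈B)
        cases (yes A⊆S) (yes S⊆B) (yes eq) _ _ = zero-at S (c-low S (subst (S ⊆_) (sym eq) ⊆-refl))
        cases (yes A⊆S) (yes S⊆B) (no _) (yes eq) _ = zero-at S (c-high S (subst (_⊆ S) eq ⊆-refl))
        -- `x` depends on `S` and hence on `B`; as `B` is a flat or `⊤`, it contains `x`, which is
        -- therefore a loop of M|B/S.
        cases (yes A⊆S) (yes S⊆B) (no _) (no _) (inj₂ (x , x∉S , dep)) = both-zero S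
          (inj₂ (atGenerator-nonflat C Ls len₁ S (loop⇒¬flat M x∉S dep ∘ proj₂ ∘ proj₂)))
          (h-zero S (*-zeroʳ′ (V M ks A S) (V-loop M ks S B x x∉S (decidable-stable (x ∈? B) (λ x∉B → B-flat x x∉B (Dependent-mono M S⊆B dep))) dep)))
        cases (yes A⊆S) (yes S⊆B) (no A≢S) (no S≢B) (inj₁ flatS) = cong (c S *_) (trans
          (evalProd-cong Ls λ ms eq → symm _ _ (len′ C Ls len₁ S ms eq) (perm ms))
          (trans (degree-flag ks (Ps ++ S ∷ Qs) <n (flag-insert M ⊥ Ps Qs S flg′ A⊆S A≢S flatS S⊆B S≢B) len₂)
            (trans (flagProduct-++ M ks ⊥ Ps (S ∷ Qs)) (trans (cong (λ q → below M ks ⊥ Ps * (V M ks A S * q)) (flagProduct-top M ks S Qs))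
              (solve 4 (λ b v w a → b :* (v :* (w :* a)) := b :* (v :* w) :* a) refl (below M ks ⊥ Ps) (V M ks A S) (V M ks S B) (above M ks Qs))))))
          where
          open +-*-Solver
          perm : ∀ ms → C ++ S ∷ ms ↭ (Ps ++ S ∷ Qs) ++ ms
          perm ms = ↭-trans (shift S C ms) (↭-sym (++⁺ʳ ms (subst (λ D → Ps ++ S ∷ Qs ↭ S ∷ D) (sym C≡) (shift S Ps Qs))))
          len₂ : length (Ps ++ S ∷ Qs) ℕ.+ length ks ≡ r
          len₂ = trans (cong (ℕ._+ length ks) (trans (↭-length (shift S Ps Qs)) (cong (suc ∘ length) (sym C≡)))) (trans (sym (ℕ.+-suc (length C) (length ks))) len)

      collect : ΣS (λ S → c S * h S) ≡ flagProduct M (k ∷ ks) ⊥ C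
      collect = begin
        ΣS (λ S → c S * (b * (V M ks A S * V M ks S B) * a))
          ≡⟨ ∑-cong (allSubsets (suc n)) (λ S → solve 4 (λ c b v a → c :* (b :* v :* a) := b :* (c :* v :* a)) refl (c S) b (V M ks A S * V M ks S B) a) ⟩
        ΣS (λ S → b * (c S * (V M ks A S * V M ks S B) * a))
          ≡⟨ trans (∑-*ˡ (allSubsets (suc n)) b _) (cong (b *_) (∑-*ʳ (allSubsets (suc n)) a _)) ⟩
        b * (ΣS (λ S → c S * (V M ks A S * V M ks S B)) * a)
          ≡⟨ cong (λ q → b * (q * a)) (sym (proj₂ (proj₂ (proj₂ cut)) ks)) ⟩
        b * (V M (k ∷ ks) A B * a)
          ≡⟨ cong₂ (λ b a → b * (V M (k ∷ ks) A B * a)) (sym (below-skip M k ks ⊥ Ps Qs flg′ lo)) (sym (above-skip M k ks A Qs (flag-drop M ⊥ Ps Qs flg′) hi)) ⟩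
        below M (k ∷ ks) ⊥ Ps * (V M (k ∷ ks) A B * above M (k ∷ ks) Qs)
          ≡⟨ cong (below M (k ∷ ks) ⊥ Ps *_) (sym (flagProduct-top M (k ∷ ks) A Qs)) ⟩
        below M (k ∷ ks) ⊥ Ps * flagProduct M (k ∷ ks) A Qs
          ≡⟨ sym (flagProduct-++ M (k ∷ ks) ⊥ Ps Qs) ⟩
        flagProduct M (k ∷ ks) ⊥ (Ps ++ Qs)
          ≡⟨ cong (flagProduct M (k ∷ ks) ⊥) (sym C≡) ⟩
        flagProduct M (k ∷ ks) ⊥ C ∎
        where
        open ≡-Reasoning
        open +-*-Solver
        a b : ℚ
        a = above M ks Qs
        b = below M ks ⊥ Ps

-- Sums over permutations

unless-* : {X : Set} (X? : Dec X) (q q′ : ℚ) → unless X? (q * q′) ≡ unless X? q * q′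
unless-* (yes _) q q′ = sym (*-zeroˡ q′)
unless-* (no _)  q q′ = refl

module _ {m : ℕ} (a : Step {m}) where

  -- `rhs` enumerates all functions, so words are arbitrary functions here too; `unless` gives
  -- weight 0 to a repeated letter.
  wordWeight : (l : ℕ) → Subset m → ℕ → ℕ → Vector (Fin m) l → ℚ
  wordWeight zero    A p P w = ind (suc P ℕ.≟ ∣ A ∣)
  wordWeight (suc l) A p P w = unless (w zero ∈? A) (edge A p P (w zero) * wordWeight l (A ▹ w zero) (suc (toℕ (w zero))) (P ℕ.+ a A (w zero)) (tail w))

  ∑-words : ∀ l A p P → ∣ A ∣ ℕ.+ l ≡ m → ∑ (allFuns l (allFin m)) (wordWeight l A p P) ≡ pathsTo a ⊤ A p P
  ∑-words zero A p P eq = trans (+-identityʳ (ind (suc P ℕ.≟ ∣ A ∣))) (sym (trans (pathSum-step a (endAt ⊤) A p P)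
    (trans (cong₂ _+_ (trans (cong (λ B → endAt B A P) (sym A≡⊤)) (endAt-yes A P))
      (∑∉-zero A (λ y y∉A → ⊥-elim (y∉A (subst (y ∈_) (sym A≡⊤) ∈⊤))))) (+-identityʳ (ind (suc P ℕ.≟ ∣ A ∣))))))
    where
    A≡⊤ : A ≡ ⊤
    A≡⊤ = ∣p∣≡n⇒p≡⊤ (trans (sym (ℕ.+-identityʳ ∣ A ∣)) eq)
  ∑-words (suc l) A p P eq = begin
    ∑ (allFuns (suc l) (allFin m)) (wordWeight (suc l) A p P)
      ≡⟨ ∑-concatMap _ (allFin m) _ ⟩
    ∑ (allFin m) (λ y → ∑ (map (Vector._∷_ y) (allFuns l (allFin m))) (wordWeight (suc l) A p P))
      ≡⟨ ∑-cong (allFin m) (λ y → trans (∑-map (Vector._∷_ y) (allFuns l (allFin m)) (wordWeight (suc l) A p P)) (first y (y ∈? A))) ⟩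
    ∑∉ A (next a (endAt ⊤) A p P)
      ≡⟨ sym (+-identityˡ _) ⟩
    0ℚ + ∑∉ A (next a (endAt ⊤) A p P)
      ≡⟨ cong (_+ ∑∉ A (next a (endAt ⊤) A p P)) (sym (endAt-no A ⊤ P A≢⊤)) ⟩
    endAt ⊤ A P + ∑∉ A (next a (endAt ⊤) A p P)
      ≡⟨ sym (pathSum-step a (endAt ⊤) A p P) ⟩
    pathsTo a ⊤ A p P ∎
    where
    open ≡-Reasoning
    A≢⊤ : A ≢ ⊤
    A≢⊤ refl = ℕ.m+1+n≢m m (trans (cong (ℕ._+ suc l) (sym (∣⊤∣≡n m))) eq)
    first : ∀ y (y∈? : Dec (y ∈ A)) →
      ∑ (allFuns l (allFin m)) (λ w → unless y∈? (edge A p P y * wordWeight l (A ▹ y) (suc (toℕ y)) (P ℕ.+ a A y) w)) ≡ unless y∈? (next a (endAt ⊤) A p P y)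
    first y (yes _)  = ∑-zero (allFuns l (allFin m)) (λ _ → refl)
    first y (no y∉A) = trans (∑-*ˡ (allFuns l (allFin m)) (edge A p P y) _)
      (cong (edge A p P y *_) (∑-words l (A ▹ y) _ _ (trans (cong (ℕ._+ l) (∣▹∣ A y∉A)) (trans (sym (ℕ.+-suc ∣ A ∣ l)) eq))))

∏from : ℕ → ℕ → (ℕ → ℚ) → ℚ
∏from zero    i F = 1ℚ
∏from (suc l) i F = F i * ∏from l (suc i) F

∏from-zero : ∀ l i F j → i ≤ j → j < i ℕ.+ l → F j ≡ 0ℚ → ∏from l i F ≡ 0ℚ
∏from-zero zero    i F j i≤j j<i Fj = ⊥-elim (ℕ.<⇒≱ (ℕ.<-≤-trans j<i (ℕ.≤-reflexive (ℕ.+-identityʳ i))) i≤j)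
∏from-zero (suc l) i F j i≤j j< Fj with i ℕ.≟ j
... | yes refl = *-zeroˡ′ (∏from l (suc i) F) Fj
... | no i≢j   = *-zeroʳ′ (F i) (∏from-zero l (suc i) F j (ℕ.≤∧≢⇒< i≤j i≢j) (ℕ.<-≤-trans j< (ℕ.≤-reflexive (ℕ.+-suc i l))) Fj)

signOf : Bool → ℚ
signOf true  = - 1ℚ
signOf false = 1ℚ

∏from-signs : ∀ {X : Set} l i F (b : X → Bool) (f : Fin l → X) → (∀ x → F (i ℕ.+ toℕ x) ≡ signOf (b (f x))) →
              ∏from l i F ≡ negOnePow (length (filterᵇ b (tabulate f)))
∏from-signs zero    i F b f F≗ = refl
∏from-signs (suc l) i F b f F≗ = trans (cong₂ _*_ (trans (cong F (sym (ℕ.+-identityʳ i))) (F≗ zero))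
    (∏from-signs l (suc i) F b (f ∘ suc) (λ x → trans (cong F (sym (ℕ.+-suc i (toℕ x)))) (F≗ (suc x))))) (first (f zero) (tabulate (f ∘ suc)))
  where
  open +-*-Solver
  first : ∀ x xs → signOf (b x) * negOnePow (length (filterᵇ b xs)) ≡ negOnePow (length (filterᵇ b (x ∷ xs)))
  first x xs with b x
  ... | true  = solve 1 (λ q → :- con 1ℚ :* q := :- q) refl (negOnePow (length (filterᵇ b xs)))
  ... | false = *-identityˡ (negOnePow (length (filterᵇ b xs)))

-- The Boolean tests and partial sums of the statement

allFin?-suc : ∀ {m} (p : Fin (suc m) → Bool) → allFin? (suc m) p ≡ p zero ∧ allFin? m (p ∘ suc)
allFin?-suc p = cong (λ l → p zero ∧ foldr _∧_ true l) (trans (map-tabulate suc p) (sym (map-tabulate (λ i → i) (p ∘ suc))))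

anyFin-suc : ∀ {m} (p : Fin (suc m) → Bool) → anyFin (suc m) p ≡ p zero ∨ anyFin m (p ∘ suc)
anyFin-suc p = cong (λ l → p zero ∨ foldr _∨_ false l) (trans (map-tabulate suc p) (sym (map-tabulate (λ i → i) (p ∘ suc))))

allFin?⁻ : ∀ {m} (p : Fin m → Bool) → allFin? m p ≡ true → ∀ i → p i ≡ true
allFin?⁻ {suc m} p eq i with p zero in p₀ | trans (sym (allFin?-suc p)) eq
allFin?⁻ {suc m} p eq zero    | true | _    = p₀
allFin?⁻ {suc m} p eq (suc i) | true | rest = allFin?⁻ (p ∘ suc) rest i

allFin?-false : ∀ {m} (p : Fin m → Bool) → allFin? m p ≡ false → ∃ λ i → p i ≡ false
allFin?-false {suc m} p eq with p zero in p₀ | trans (sym (allFin?-suc p)) eq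
... | false | _    = zero , p₀
... | true  | rest = let (i , pi) = allFin?-false (p ∘ suc) rest in suc i , pi

allFin?⁺ : ∀ {m} (p : Fin m → Bool) → (∀ i → p i ≡ true) → allFin? m p ≡ true
allFin?⁺ {zero}  p h = refl
allFin?⁺ {suc m} p h = trans (allFin?-suc p) (cong₂ _∧_ (h zero) (allFin?⁺ (p ∘ suc) (h ∘ suc)))

anyFin⁺ : ∀ {m} (p : Fin m → Bool) i → p i ≡ true → anyFin m p ≡ true
anyFin⁺ p zero    pi = trans (anyFin-suc p) (cong (_∨ anyFin _ (p ∘ suc)) pi)
anyFin⁺ p (suc i) pi = trans (anyFin-suc p) (trans (cong (p zero ∨_) (anyFin⁺ (p ∘ suc) i pi)) (∨-zeroʳ (p zero)))

anyFin⁻ : ∀ {m} (p : Fin m → Bool) → anyFin m p ≡ true → ∃ λ i → p i ≡ true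
anyFin⁻ {suc m} p eq with p zero in p₀ | trans (sym (anyFin-suc p)) eq
... | true  | _    = zero , p₀
... | false | rest = let (i , pi) = anyFin⁻ (p ∘ suc) rest in suc i , pi

subsetEqᵇ⁺ : ∀ {m} (A B : Subset m) → (∀ x → lookup A x ≡ lookup B x) → subsetEqᵇ A B ≡ true
subsetEqᵇ⁺ A B h = allFin?⁺ _ λ x → trans (cong (λ b → not (b xor lookup B x)) (h x)) (cong not (xor-same (lookup B x)))

subsetEqᵇ⁻ : ∀ {m} (A B : Subset m) → subsetEqᵇ A B ≡ true → ∀ x → lookup A x ≡ lookup B x
subsetEqᵇ⁻ A B eq x = agree (lookup A x) (lookup B x) (allFin?⁻ _ eq x)
  where
  agree : ∀ a b → not (a xor b) ≡ true → a ≡ b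
  agree true  true  _ = refl
  agree false false _ = refl

does-⇔ : {X Y : Set} (X? : Dec X) (Y? : Dec Y) → (X → Y) → (Y → X) → does X? ≡ does Y?
does-⇔ (yes x) Y? f g = sym (dec-true Y? (f x))
does-⇔ (no ¬x) Y? f g = sym (dec-false Y? (¬x ∘ g))

-- Identifies the complement of K(w) with the positions where `defect` is 1.
closure-unchanged : ∀ {m} (M : Matroid m) A y → subsetEqᵇ (cl M A) (cl M (A ▹ y)) ≡ does (dependent? M A y)
closure-unchanged {m} M A y = go (dependent? M A y)
  where
  open Matroid M
  lookup-cl : ∀ A x → lookup (cl M A) x ≡ does (dependent? M A x)
  lookup-cl A x = lookup∘tabulate _ x
  go : Dec (Dependent M A y) → subsetEqᵇ (cl M A) (cl M (A ▹ y)) ≡ does (dependent? M A y)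
  go (yes dep) = trans (subsetEqᵇ⁺ (cl M A) (cl M (A ▹ y)) λ x → trans (lookup-cl A x) (trans
      (does-⇔ (dependent? M A x) (dependent? M (A ▹ y) x) (Dependent-mono M (A⊆A▹y A y)) (λ dep′ → ℕ.≤-antisym
        (ℕ.≤-trans (rk-mono (▹-⊆ (A⊆A▹y (A ▹ y) x ∘ A⊆A▹y A y) (y∈A▹y (A ▹ y) x))) (ℕ.≤-reflexive (trans dep′ dep))) (rk-mono (A⊆A▹y A x))))
      (sym (lookup-cl (A ▹ y) x)))) (sym (dec-true (dependent? M A y) dep))
  go (no ¬dep) = trans (¬-not λ eq → ¬dep (does⁻ (dependent? M A y)
      (trans (sym (lookup-cl A y)) (trans (subsetEqᵇ⁻ (cl M A) (cl M (A ▹ y)) eq y) (trans (lookup-cl (A ▹ y) y)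
        (dec-true (dependent? M (A ▹ y) y) (ℕ.≤-antisym (rk-mono (▹-⊆ ⊆-refl (y∈A▹y A y))) (rk-mono (A⊆A▹y (A ▹ y) y)))))))))
    (sym (dec-false (dependent? M A y) ¬dep))

accumulate : (ℕ → ℕ) → ℕ → ℕ
accumulate C zero    = 0
accumulate C (suc i) = accumulate C i ℕ.+ C i

sum-allFin-suc : ∀ {l} (f : Fin (suc l) → ℕ) → sumℕ (map f (allFin (suc l))) ≡ f zero ℕ.+ sumℕ (map (f ∘ suc) (allFin l))
sum-allFin-suc f = cong (λ xs → f zero ℕ.+ sumℕ xs) (trans (map-tabulate suc f) (sym (map-tabulate (λ i → i) (f ∘ suc))))

sum-map-zero : ∀ {X : Set} (xs : List X) (f : X → ℕ) → (∀ x → f x ≡ 0) → sumℕ (map f xs) ≡ 0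
sum-map-zero []       f f≗0 = refl
sum-map-zero (x ∷ xs) f f≗0 = cong₂ ℕ._+_ (f≗0 x) (sum-map-zero xs f f≗0)

-- The offset `i` serves the induction, which removes the first entry of `c` and moves its value
-- into the accumulated part.
accumulate-prefix : ∀ {l} (c : Fin l → ℕ) C i k → k ≤ l → (∀ x → c x ≡ C (i ℕ.+ toℕ x)) →
  accumulate C i ℕ.+ sumℕ (map (λ j → if toℕ j <ᵇ k then c j else 0) (allFin l)) ≡ accumulate C (i ℕ.+ k)
accumulate-prefix {l} c C i zero k≤l c≗ = trans (cong (accumulate C i ℕ.+_) (sum-map-zero (allFin l) _ λ _ → refl)) (trans (ℕ.+-identityʳ _) (cong (accumulate C) (sym (ℕ.+-identityʳ i))))
accumulate-prefix {suc l} c C i (suc k) (s≤s k≤l) c≗ = begin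
  accumulate C i ℕ.+ sumℕ (map (λ j → if toℕ j <ᵇ suc k then c j else 0) (allFin (suc l)))
    ≡⟨ cong (accumulate C i ℕ.+_) (sum-allFin-suc (λ j → if toℕ j <ᵇ suc k then c j else 0)) ⟩
  accumulate C i ℕ.+ (c zero ℕ.+ s)
    ≡⟨ sym (ℕ.+-assoc (accumulate C i) (c zero) s) ⟩
  accumulate C i ℕ.+ c zero ℕ.+ s
    ≡⟨ cong (λ q → accumulate C i ℕ.+ q ℕ.+ s) (trans (c≗ zero) (cong C (ℕ.+-identityʳ i))) ⟩
  accumulate C (suc i) ℕ.+ s
    ≡⟨ accumulate-prefix (c ∘ suc) C (suc i) k k≤l (λ x → trans (c≗ (suc x)) (cong C (ℕ.+-suc i (toℕ x)))) ⟩
  accumulate C (suc i ℕ.+ k)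
    ≡⟨ cong (accumulate C) (sym (ℕ.+-suc i k)) ⟩
  accumulate C (i ℕ.+ suc k) ∎
  where
  open ≡-Reasoning
  s : ℕ
  s = sumℕ (map (λ j → if toℕ j <ᵇ k then c (suc j) else 0) (allFin l))

sum-map-cong : ∀ {X : Set} (xs : List X) {f g : X → ℕ} → (∀ x → f x ≡ g x) → sumℕ (map f xs) ≡ sumℕ (map g xs)
sum-map-cong []       f≗g = refl
sum-map-cong (x ∷ xs) f≗g = cong₂ ℕ._+_ (f≗g x) (sum-map-cong xs f≗g)

≤ᵇ-<ᵇ-suc : ∀ i k → (i ≤ᵇ k) ≡ (i <ᵇ suc k)
≤ᵇ-<ᵇ-suc zero    k = refl
≤ᵇ-<ᵇ-suc (suc i) k = refl

extend : ∀ {X : Set} {l} → X → Vector X l → ℕ → X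
extend {l = zero}  x₀ f k       = x₀
extend {l = suc l} x₀ f zero    = f zero
extend {l = suc l} x₀ f (suc k) = extend x₀ (f ∘ suc) k

extend-toℕ : ∀ {X : Set} {l} (x₀ : X) (f : Vector X l) i → extend x₀ f (toℕ i) ≡ f i
extend-toℕ x₀ f zero    = refl
extend-toℕ x₀ f (suc i) = extend-toℕ x₀ (f ∘ suc) i

-- Here X is "ascent", X′ "descent", Y "s ≥ 0" and Y′ "in I′". The weight is nonzero exactly when
-- being a descent and lying in I′ agree, and then a descent counts -1.
ε-signs : {X X′ Y Y′ : Set} (X? : Dec X) (X′? : Dec X′) (Y? : Dec Y) (Y′? : Dec Y′) →
  (X → ¬ X′) → (¬ X → X′) → (Y → ¬ Y′) → (¬ Y → Y′) →
  ε X? Y? ≡ (if not (does X′? xor does Y′?) then signOf (does X′?) else 0ℚ)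
ε-signs (yes x) (yes x′) _ _ f _ _ _ = ⊥-elim (f x x′)
ε-signs (no ¬x) (no ¬x′) _ _ _ g _ _ = ⊥-elim (¬x′ (g ¬x))
ε-signs _ _ (yes y) (yes y′) _ _ f _ = ⊥-elim (f y y′)
ε-signs _ _ (no ¬y) (no ¬y′) _ _ _ g = ⊥-elim (¬y′ (g ¬y))
ε-signs (yes _) (no _) (yes _) (no _) _ _ _ _ = refl
ε-signs (yes _) (no _) (no _) (yes _) _ _ _ _ = refl
ε-signs (no _) (yes _) (yes _) (no _) _ _ _ _ = refl
ε-signs (no _) (yes _) (no _) (yes _) _ _ _ _ = refl

-- The weight of a single word

module Word {n : ℕ} (M : Matroid (suc n)) (ks : List ℕ) (w : Vector (Fin (suc n)) (suc n)) where
  open Matroid M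

  W : ℕ → Fin (suc n)
  W = extend zero w

  W-toℕ : ∀ i → W (toℕ i) ≡ w i
  W-toℕ = extend-toℕ zero w

  W-< : ∀ {i} (i<N : i < suc n) → W i ≡ w (Fin.fromℕ< i<N)
  W-< i<N = trans (cong W (sym (Fin.toℕ-fromℕ< i<N))) (W-toℕ (Fin.fromℕ< i<N))

  visited : ℕ → Subset (suc n)
  visited zero    = ⊥
  visited (suc i) = visited i ▹ W i

  c : ℕ → ℕ
  c i = exponent M ks (visited i) (W i)

  previous : ℕ → ℕ
  previous zero    = 0
  previous (suc i) = suc (toℕ (W i))

  step-weight : ℕ → ℚ
  step-weight i = edge (visited i) (previous i) (accumulate c i) (W i)

  factor : ℕ → ℚ
  factor i = unless (W i ∈? visited i) (step-weight i)

  wordWeight-product : ∀ l i (u : Vector (Fin (suc n)) l) → (∀ x → u x ≡ W (i ℕ.+ toℕ x)) →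
    wordWeight (exponent M ks) l (visited i) (previous i) (accumulate c i) u ≡
    ∏from l i factor * ind (suc (accumulate c (i ℕ.+ l)) ℕ.≟ ∣ visited (i ℕ.+ l) ∣)
  wordWeight-product zero i u u≗ = trans (cong (λ j → ind (suc (accumulate c j) ℕ.≟ ∣ visited j ∣)) (sym (ℕ.+-identityʳ i))) (sym (*-identityˡ _))
  wordWeight-product (suc l) i u u≗ = begin
    after-step (u zero)
      ≡⟨ cong after-step (trans (u≗ zero) (cong W (ℕ.+-identityʳ i))) ⟩
    after-step (W i)
      ≡⟨ unless-* (W i ∈? visited i) (step-weight i) _ ⟩
    factor i * wordWeight (exponent M ks) l (visited (suc i)) (previous (suc i)) (accumulate c (suc i)) (tail u)
      ≡⟨ cong (factor i *_) (wordWeight-product l (suc i) (tail u) (λ x → trans (u≗ (suc x)) (cong W (ℕ.+-suc i (toℕ x))))) ⟩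
    factor i * (∏from l (suc i) factor * end (suc i ℕ.+ l))
      ≡⟨ sym (*-assoc (factor i) (∏from l (suc i) factor) _) ⟩
    ∏from (suc l) i factor * end (suc i ℕ.+ l)
      ≡⟨ cong (λ j → ∏from (suc l) i factor * end j) (sym (ℕ.+-suc i l)) ⟩
    ∏from (suc l) i factor * end (i ℕ.+ suc l) ∎
    where
    open ≡-Reasoning
    end : ℕ → ℚ
    end j = ind (suc (accumulate c j) ℕ.≟ ∣ visited j ∣)
    after-step : Fin (suc n) → ℚ
    after-step y = unless (y ∈? visited i) (edge (visited i) (previous i) (accumulate c i) y *
      wordWeight (exponent M ks) l (visited i ▹ y) (suc (toℕ y)) (accumulate c i ℕ.+ exponent M ks (visited i) y) (tail u))

  visited⁺ : ∀ {j k} → j < k → W j ∈ visited k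
  visited⁺ {j} {suc k} j<sk with ℕ.m≤n⇒m<n∨m≡n (ℕ.≤-pred j<sk)
  ... | inj₁ j<k  = A⊆A▹y (visited k) (W k) (visited⁺ j<k)
  ... | inj₂ refl = y∈A▹y (visited k) (W k)

  visited⁻ : ∀ k {x} → x ∈ visited k → ∃ λ j → j < k × W j ≡ x
  visited⁻ zero    x∈ = ⊥-elim (∉⊥ x∈)
  visited⁻ (suc k) x∈ with ∈▹⁻ (visited k) x∈
  ... | inj₁ x∈′  = let (j , j<k , eq) = visited⁻ k x∈′ in j , ℕ.m≤n⇒m≤1+n j<k , eq
  ... | inj₂ refl = k , ℕ.≤-refl , refl

  prefix-visited : ∀ k → k ≤ suc n → prefix w k ≡ visited k
  prefix-visited k k≤N = ⊆-antisym to from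
    where
    condition : Fin (suc n) → Fin (suc n) → Bool
    condition x j = (toℕ j <ᵇ k) ∧ (w j == x)
    both : ∀ {a b} → a ∧ b ≡ true → a ≡ true × b ≡ true
    both {true} {true} _ = refl , refl
    to : prefix w k ⊆ visited k
    to {x} x∈ = let (j , eq) = anyFin⁻ (condition x) (trans (sym (lookup∘tabulate (λ x → anyFin (suc n) (condition x)) x)) ([]=⇒lookup x∈))
                    (j<k , wj≡x) = both eq in
      subst (_∈ visited k) (trans (W-toℕ j) (does⁻ (w j Fin.≟ x) wj≡x)) (visited⁺ (does⁻ (suc (toℕ j) ≤? k) j<k))
    from : visited k ⊆ prefix w k
    from {x} x∈ = let (j , j<k , Wj≡x) = visited⁻ k x∈
                      j<N = ℕ.<-≤-trans j<k k≤N
                      i = Fin.fromℕ< j<N in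
      lookup⇒[]= x (prefix w k) (trans (lookup∘tabulate (λ x → anyFin (suc n) (condition x)) x) (anyFin⁺ (condition x) i (cong₂ _∧_
        (dec-true (suc (toℕ i) ≤? k) (subst (_< k) (sym (Fin.toℕ-fromℕ< j<N)) j<k))
        (dec-true (w i Fin.≟ x) (trans (sym (W-< j<N)) Wj≡x)))))

  repeated : ∀ {i j} → i < j → j < suc n → W i ≡ W j → ∏from (suc n) 0 factor ≡ 0ℚ
  repeated {i} {j} i<j j<N eq = ∏from-zero (suc n) 0 factor j z≤n j<N (vanish (W j ∈? visited j))
    where
    vanish : (W∈? : Dec (W j ∈ visited j)) → unless W∈? (step-weight j) ≡ 0ℚ
    vanish (yes _) = refl
    vanish (no ∉) = ⊥-elim (∉ (subst (_∈ visited j) eq (visited⁺ i<j)))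

  not-bijective : isBijᵇ w ≡ false → ∏from (suc n) 0 factor ≡ 0ℚ
  not-bijective ¬bij = let (i , ¬all) = allFin?-false _ ¬bij
                           (j , ≢∨) = allFin?-false _ ¬all in
    collide i j (i Fin.≟ j) (w i Fin.≟ w j) ≢∨
    where
    collide : ∀ i j (i≟j : Dec (i ≡ j)) (wi≟wj : Dec (w i ≡ w j)) → does i≟j ∨ not (does wi≟wj) ≡ false → ∏from (suc n) 0 factor ≡ 0ℚ
    collide i j (no i≢j) (yes wi≡wj) _ with ℕ.<-cmp (toℕ i) (toℕ j)
    ... | tri< i<j _ _ = repeated i<j (Fin.toℕ<n j) (trans (W-toℕ i) (trans wi≡wj (sym (W-toℕ j))))
    ... | tri≈ _ eq _  = ⊥-elim (i≢j (Fin.toℕ-injective eq))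
    ... | tri> _ _ j<i = repeated j<i (Fin.toℕ<n i) (trans (W-toℕ j) (trans (sym wi≡wj) (sym (W-toℕ i))))

  module Bijective (bij : isBijᵇ w ≡ true) where

    w-injective : ∀ {i j} → w i ≡ w j → i ≡ j
    w-injective {i} {j} wi≡wj = from-bool (i Fin.≟ j) (w i Fin.≟ w j) (allFin?⁻ _ (allFin?⁻ _ bij i) j)
      where
      from-bool : (i≟j : Dec (i ≡ j)) (wi≟wj : Dec (w i ≡ w j)) → does i≟j ∨ not (does wi≟wj) ≡ true → i ≡ j
      from-bool (yes i≡j) _ _ = i≡j
      from-bool (no _) (no wi≢wj) _ = ⊥-elim (wi≢wj wi≡wj)

    W-injective : ∀ {i j} → i < suc n → j < suc n → W i ≡ W j → i ≡ j
    W-injective i<N j<N eq = trans (sym (Fin.toℕ-fromℕ< i<N)) (trans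
      (cong toℕ (w-injective (trans (sym (W-< i<N)) (trans eq (W-< j<N))))) (Fin.toℕ-fromℕ< j<N))

    fresh : ∀ {i} → i < suc n → W i ∉ visited i
    fresh {i} i<N W∈ = let (j , j<i , eq) = visited⁻ i W∈ in ℕ.<-irrefl (W-injective (ℕ.<-trans j<i i<N) i<N eq) j<i

    ∣visited∣ : ∀ i → i ≤ suc n → ∣ visited i ∣ ≡ i
    ∣visited∣ zero    _   = ∣⊥∣≡0 (suc n)
    ∣visited∣ (suc i) i<N = trans (∣▹∣ (visited i) (fresh i<N)) (cong suc (∣visited∣ i (ℕ.<⇒≤ i<N)))

    factor-fresh : ∀ {i} → i < suc n → factor i ≡ ε (previous i ≤? toℕ (W i)) (i ≤? accumulate c i)
    factor-fresh {i} i<N = trans (drop (W i ∈? visited i)) (cong (λ k → ε (previous i ≤? toℕ (W i)) (k ≤? accumulate c i)) (∣visited∣ i (ℕ.<⇒≤ i<N)))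
      where
      drop : (W∈? : Dec (W i ∈ visited i)) → unless W∈? (step-weight i) ≡ step-weight i
      drop (yes W∈) = ⊥-elim (fresh i<N W∈)
      drop (no _)   = refl

    module _ (d : Vector ℕ (suc n)) (count-d : ∀ i → count ks (toℕ i) ≡ d i) where

      c-toℕ : ∀ j → (if inK M w j then d j else suc (d j)) ≡ c (toℕ j)
      c-toℕ j = trans (cong (λ b → if not b then d j else suc (d j)) inK≡) (trans (if-not (does dep?) (d j))
        (cong₂ ℕ._+_ (trans (sym (count-d j)) (cong (count ks) (sym (∣visited∣ (toℕ j) (ℕ.<⇒≤ (Fin.toℕ<n j)))))) refl))
        where
        dep? = dependent? M (visited (toℕ j)) (W (toℕ j))
        inK≡ : subsetEqᵇ (cl M (prefix w (toℕ j))) (cl M (prefix w (suc (toℕ j)))) ≡ does dep?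
        inK≡ = trans (cong₂ (λ A B → subsetEqᵇ (cl M A) (cl M B)) (prefix-visited (toℕ j) (ℕ.<⇒≤ (Fin.toℕ<n j))) (prefix-visited (suc (toℕ j)) (Fin.toℕ<n j)))
          (closure-unchanged M (visited (toℕ j)) (W (toℕ j)))
        if-not : ∀ b k → (if not b then k else suc k) ≡ k ℕ.+ bit b
        if-not true  k = sym (ℕ.+-comm k 1)
        if-not false k = sym (ℕ.+-identityʳ k)

      -- Membership in I′ is the condition s < 0: after the letter at position i, the prefix has i +
      -- 1 elements and exponent total c_0 + ... + c_i.
      inI'-height : ∀ i → inI' d (inK M w) i ≡ does (suc (accumulate c (suc (toℕ i))) ≤? suc (toℕ i))
      inI'-height i = cong (_<ᵇ suc (toℕ i)) (trans
        (sum-map-cong (allFin (suc n)) (λ j → cong (λ b → if b then (if inK M w j then d j else suc (d j)) else 0) (≤ᵇ-<ᵇ-suc (toℕ j) (toℕ i))))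
        (accumulate-prefix (λ j → if inK M w j then d j else suc (d j)) c 0 (suc (toℕ i)) (s≤s (ℕ.<⇒≤ (Fin.toℕ<n i))) c-toℕ))

      factor-suc : ∀ (i : Fin n) → factor (suc (toℕ i)) ≡
        (if not (inDes w i xor inI' d (inK M w) i) then signOf (inDes w i) else 0ℚ)
      factor-suc i = trans (factor-fresh si<N) (trans
        (ε-signs (suc x ≤? y) (suc y ≤? x) (suc (toℕ i) ≤? accumulate c (suc (toℕ i))) (suc (accumulate c (suc (toℕ i))) ≤? suc (toℕ i))
          (λ x<y y<x → ℕ.<-asym x<y y<x) (λ x≮y → ℕ.≤∧≢⇒< (ℕ.≮⇒≥ x≮y) y≢x)
          (λ le gt → ℕ.<⇒≱ gt le) ℕ.≰⇒>)
        (cong₂ (λ a b → if not (a xor b) then signOf a else 0ℚ) descents (sym (inI'-height i))))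
        where
        si<N : suc (toℕ i) < suc n
        si<N = s≤s (Fin.toℕ<n i)
        x y : ℕ
        x = toℕ (W (toℕ i))
        y = toℕ (W (suc (toℕ i)))
        y≢x : y ≢ x
        y≢x eq = ℕ.1+n≢n (W-injective si<N (ℕ.<⇒≤ si<N) (Fin.toℕ-injective eq))
        descents : does (suc y ≤? x) ≡ inDes w i
        descents = cong₂ (λ a b → toℕ a <ᵇ toℕ b) (W-toℕ (suc i)) (trans (cong W (sym (Fin.toℕ-inject₁ i))) (W-toℕ (inject₁ i)))

      factor-zero : factor 0 ≡ 1ℚ
      factor-zero = factor-fresh (s≤s z≤n)

      wrong-descents : desCond M d w ≡ false → ∏from (suc n) 0 factor ≡ 0ℚ
      wrong-descents ¬des = let (i , eq) = allFin?-false _ ¬des in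
        ∏from-zero (suc n) 0 factor (suc (toℕ i)) z≤n (s≤s (Fin.toℕ<n i)) (trans (factor-suc i) (cong (λ b → if b then signOf (inDes w i) else 0ℚ) eq))

      right-descents : desCond M d w ≡ true → ∏from (suc n) 0 factor ≡ negOnePow (des w)
      right-descents des≡ = trans (cong (_* ∏from n 1 factor) factor-zero) (trans (*-identityˡ (∏from n 1 factor))
        (∏from-signs n 1 factor (inDes w) (λ i → i) (λ i → trans (factor-suc i) (cong (λ b → if b then signOf (inDes w i) else 0ℚ) (allFin?⁻ _ des≡ i)))))

      -- The invariant of `wrong-rank` along one word, with the exponents d_i now included.
      height-rank : ∀ i → i ≤ suc n → accumulate c i ℕ.+ rk (visited i) ≡ accumulate (count ks) i ℕ.+ (i ℕ.+ rk ⊥)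
      height-rank zero    _   = refl
      height-rank (suc i) i<N = begin
        accumulate c i ℕ.+ (count ks ∣ visited i ∣ ℕ.+ δ) ℕ.+ ρ
          ≡⟨ cong (λ k → accumulate c i ℕ.+ (count ks k ℕ.+ δ) ℕ.+ ρ) (∣visited∣ i (ℕ.<⇒≤ i<N)) ⟩
        accumulate c i ℕ.+ (count ks i ℕ.+ δ) ℕ.+ ρ
          ≡⟨ shuffle₁ (accumulate c i) (count ks i) δ ρ ⟩
        count ks i ℕ.+ (accumulate c i ℕ.+ (δ ℕ.+ ρ))
          ≡⟨ cong (λ t → count ks i ℕ.+ (accumulate c i ℕ.+ t)) (defect-rk M (visited i) (W i)) ⟩
        count ks i ℕ.+ (accumulate c i ℕ.+ suc (rk (visited i)))
          ≡⟨ cong (count ks i ℕ.+_) (trans (ℕ.+-suc (accumulate c i) _) (cong suc (height-rank i (ℕ.<⇒≤ i<N)))) ⟩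
        count ks i ℕ.+ suc (accumulate (count ks) i ℕ.+ (i ℕ.+ rk ⊥))
          ≡⟨ shuffle₂ (count ks i) (accumulate (count ks) i) i (rk ⊥) ⟩
        accumulate (count ks) i ℕ.+ count ks i ℕ.+ (suc i ℕ.+ rk ⊥) ∎
        where
        open ≡-Reasoning
        δ ρ : ℕ
        δ = defect M (visited i) (W i)
        ρ = rk (visited (suc i))
        shuffle₁ : ∀ a k d p → a ℕ.+ (k ℕ.+ d) ℕ.+ p ≡ k ℕ.+ (a ℕ.+ (d ℕ.+ p))
        shuffle₁ = solve-∀
        shuffle₂ : ∀ k a i p → k ℕ.+ suc (a ℕ.+ (i ℕ.+ p)) ≡ a ℕ.+ k ℕ.+ (suc i ℕ.+ p)
        shuffle₂ = solve-∀

      accumulate-d : accumulate (count ks) (suc n) ≡ sumVec d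
      accumulate-d = trans (sym (accumulate-prefix d (count ks) 0 (suc n) ℕ.≤-refl (λ x → sym (count-d x))))
        (sum-map-cong (allFin (suc n)) (λ j → cong (λ b → if b then d j else 0) (dec-true (suc (toℕ j) ≤? suc n) (Fin.toℕ<n j))))

      -- Because the d_i sum to r, the total exponent of a bijective word is r + (n+1) - (r+1) = n,
      -- the number of denominators, so the closing condition holds automatically.
      ends-correctly : ∀ {r} → rk ⊤ ≡ suc r → sumVec d ≡ r → ind (suc (accumulate c (suc n)) ℕ.≟ ∣ visited (suc n) ∣) ≡ 1ℚ
      ends-correctly {r} rank sum-d = ind-yes (suc (accumulate c (suc n)) ℕ.≟ ∣ visited (suc n) ∣) (trans (ℕ.+-cancelʳ-≡ r _ _ (begin
        suc (accumulate c (suc n)) ℕ.+ r          ≡⟨ sym (ℕ.+-suc (accumulate c (suc n)) r) ⟩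
        accumulate c (suc n) ℕ.+ suc r            ≡⟨ cong (accumulate c (suc n) ℕ.+_) (trans (sym rank) (cong rk (sym visited≡⊤))) ⟩
        accumulate c (suc n) ℕ.+ rk (visited (suc n))  ≡⟨ height-rank (suc n) ℕ.≤-refl ⟩
        accumulate (count ks) (suc n) ℕ.+ (suc n ℕ.+ rk ⊥)  ≡⟨ cong₂ (λ s t → s ℕ.+ (suc n ℕ.+ t)) (trans accumulate-d sum-d) (rk-⊥ M) ⟩
        r ℕ.+ (suc n ℕ.+ 0)                       ≡⟨ trans (cong (r ℕ.+_) (ℕ.+-identityʳ (suc n))) (ℕ.+-comm r (suc n)) ⟩
        suc n ℕ.+ r                               ∎)) (sym (∣visited∣ (suc n) ℕ.≤-refl)))
        where
        open ≡-Reasoning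
        visited≡⊤ : visited (suc n) ≡ ⊤
        visited≡⊤ = ∣p∣≡n⇒p≡⊤ (∣visited∣ (suc n) ℕ.≤-refl)

  wordWeight-closed : ∀ {r} (d : Vector ℕ (suc n)) → (∀ i → count ks (toℕ i) ≡ d i) → rk ⊤ ≡ suc r → sumVec d ≡ r →
    wordWeight (exponent M ks) (suc n) ⊥ 0 0 w ≡ (if isBijᵇ w ∧ desCond M d w then negOnePow (des w) else 0ℚ)
  wordWeight-closed d count-d rank sum-d = trans (wordWeight-product (suc n) 0 w (λ x → sym (W-toℕ x))) (cases (isBijᵇ w) refl (desCond M d w) refl)
    where
    end : ℚ
    end = ind (suc (accumulate c (suc n)) ℕ.≟ ∣ visited (suc n) ∣)
    cases : ∀ b → isBijᵇ w ≡ b → ∀ b′ → desCond M d w ≡ b′ → ∏from (suc n) 0 factor * end ≡ (if b ∧ b′ then negOnePow (des w) else 0ℚ)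
    cases false ¬bij _     _    = *-zeroˡ′ end (not-bijective ¬bij)
    cases true  bij  false ¬des = *-zeroˡ′ end (Bijective.wrong-descents bij d count-d ¬des)
    cases true  bij  true  des≡ = trans (cong₂ _*_ (Bijective.right-descents bij d count-d des≡) (Bijective.ends-correctly bij d count-d rank sum-d)) (*-identityʳ (negOnePow (des w)))

-- From exponent vectors to lists of factors, and the conclusion

word : ∀ {n} → Vector ℕ (suc n) → List ℕ
word {n} d = concatMap (λ k → replicate (d k) (toℕ k)) (allFin (suc n))

Λprod-word : ∀ n d → Λprod n d ≡ map (Λ n) (word d)
Λprod-word n d = sym (trans (map-concatMap (Λ n) (λ k → replicate (d k) (toℕ k)) (allFin (suc n)))
  (concatMap-cong (λ k → map-replicate (Λ n) (d k) (toℕ k)) (allFin (suc n))))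

word-length : ∀ {n} (d : Vector ℕ (suc n)) → length (word d) ≡ sumVec d
word-length {n} d = go (allFin (suc n))
  where
  go : ∀ xs → length (concatMap (λ k → replicate (d k) (toℕ k)) xs) ≡ sumℕ (map d xs)
  go []       = refl
  go (x ∷ xs) = trans (length-++ (replicate (d x) (toℕ x))) (cong₂ ℕ._+_ (length-replicate (d x)) (go xs))

word-bounded : ∀ {n} (d : Vector ℕ (suc n)) → All (_< suc n) (word d)
word-bounded {n} d = go (allFin (suc n))
  where
  go : ∀ xs → All (_< suc n) (concatMap (λ k → replicate (d k) (toℕ k)) xs)
  go []       = []
  go (x ∷ xs) = All.++⁺ (All.replicate⁺ (d x) (Fin.toℕ<n x)) (go xs)

count-++ : ∀ ks ls i → count (ks ++ ls) i ≡ count ks i ℕ.+ count ls i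
count-++ []       ls i = refl
count-++ (k ∷ ks) ls i = trans (cong (bit (does (i ℕ.≟ k)) ℕ.+_) (count-++ ks ls i)) (sym (ℕ.+-assoc (bit (does (i ℕ.≟ k))) _ _))

count-replicate : ∀ c i → count (replicate c i) i ≡ c
count-replicate zero    i = refl
count-replicate (suc c) i = cong₂ (λ b k → bit b ℕ.+ k) (dec-true (i ℕ.≟ i) refl) (count-replicate c i)

count-replicate-≢ : ∀ c {i k} → i ≢ k → count (replicate c k) i ≡ 0
count-replicate-≢ zero    i≢k = refl
count-replicate-≢ (suc c) {i} {k} i≢k = cong₂ (λ b l → bit b ℕ.+ l) (dec-false (i ℕ.≟ k) i≢k) (count-replicate-≢ c i≢k)

sum-single : ∀ {l} (i : Fin l) (f : Fin l → ℕ) → (∀ j → j ≢ i → f j ≡ 0) → sumℕ (map f (allFin l)) ≡ f i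
sum-single {suc l} zero    f f≡0 = trans (sum-allFin-suc f)
  (trans (cong (f zero ℕ.+_) (sum-map-zero (allFin l) (f ∘ suc) (λ j → f≡0 (suc j) λ ()))) (ℕ.+-identityʳ (f zero)))
sum-single {suc l} (suc i) f f≡0 = trans (sum-allFin-suc f)
  (cong₂ ℕ._+_ (f≡0 zero λ ()) (sum-single i (f ∘ suc) (λ j j≢i → f≡0 (suc j) (j≢i ∘ Fin.suc-injective))))

count-word : ∀ {n} (d : Vector ℕ (suc n)) i → count (word d) (toℕ i) ≡ d i
count-word {n} d i = trans (go (allFin (suc n)))
  (trans (sum-single i _ (λ j j≢i → count-replicate-≢ (d j) (λ eq → j≢i (Fin.toℕ-injective (sym eq))))) (count-replicate (d i) (toℕ i)))
  where
  go : ∀ xs → count (concatMap (λ k → replicate (d k) (toℕ k)) xs) (toℕ i) ≡ sumℕ (map (λ k → count (replicate (d k) (toℕ k)) (toℕ i)) xs)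
  go []       = refl
  go (x ∷ xs) = trans (count-++ (replicate (d x) (toℕ x)) _ (toℕ i)) (cong (count (replicate (d x) (toℕ x)) (toℕ i) ℕ.+_) (go xs))

rhs-pathsTo : ∀ n r (M : Matroid (suc n)) → Matroid.rk M ⊤ ≡ suc r → (d : Vector ℕ (suc n)) → sumVec d ≡ r →
              rhs n r M d ≡ negOnePow (n ∸ r) * between (exponent M (word d)) ⊥ ⊤
rhs-pathsTo n r M rank d sum-d = begin
  rhs n r M d
    ≡⟨ ∑-cong words (λ w → factor-out (isBijᵇ w ∧ desCond M d w) (des w)) ⟩
  ∑ words (λ w → negOnePow (n ∸ r) * (if isBijᵇ w ∧ desCond M d w then negOnePow (des w) else 0ℚ))
    ≡⟨ ∑-*ˡ words (negOnePow (n ∸ r)) _ ⟩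
  negOnePow (n ∸ r) * ∑ words (λ w → if isBijᵇ w ∧ desCond M d w then negOnePow (des w) else 0ℚ)
    ≡⟨ cong (negOnePow (n ∸ r) *_) (∑-cong words (λ w → sym (Word.wordWeight-closed M (word d) w d (count-word d) rank sum-d))) ⟩
  negOnePow (n ∸ r) * ∑ words (wordWeight (exponent M (word d)) (suc n) ⊥ 0 0)
    ≡⟨ cong (negOnePow (n ∸ r) *_) (∑-words (exponent M (word d)) (suc n) ⊥ 0 0 (cong (ℕ._+ suc n) (∣⊥∣≡0 (suc n)))) ⟩
  negOnePow (n ∸ r) * pathsTo (exponent M (word d)) ⊤ ⊥ 0 0
    ≡⟨ cong (λ P → negOnePow (n ∸ r) * pathsTo (exponent M (word d)) ⊤ ⊥ 0 P) (sym (∣⊥∣≡0 (suc n))) ⟩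
  negOnePow (n ∸ r) * between (exponent M (word d)) ⊥ ⊤ ∎
  where
  open ≡-Reasoning
  words = allFuns (suc n) (allFin (suc n))
  factor-out : ∀ b k → (if b then negOnePow ((n ∸ r) ℕ.+ k) else 0ℚ) ≡ negOnePow (n ∸ r) * (if b then negOnePow k else 0ℚ)
  factor-out true  k = negOnePow-+ (n ∸ r) k
  factor-out false k = sym (*-zeroʳ (negOnePow (n ∸ r)))

sgn-total : ∀ n r (M : Matroid (suc n)) → Matroid.rk M ⊤ ≡ suc r → sgn M ⊥ * sgn M ⊤ ≡ negOnePow (n ∸ r)
sgn-total n r M rank = begin
  sgn M ⊥ * sgn M ⊤
    ≡⟨ cong₂ (λ i j → negOnePow i * negOnePow j) (cong₂ ℕ._+_ (∣⊥∣≡0 (suc n)) (rk-⊥ M)) (cong₂ ℕ._+_ (∣⊤∣≡n (suc n)) rank) ⟩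
  1ℚ * negOnePow (suc n ℕ.+ suc r)
    ≡⟨ *-identityˡ (negOnePow (suc n ℕ.+ suc r)) ⟩
  negOnePow (suc n ℕ.+ suc r)
    ≡⟨ cong (λ k → negOnePow (suc k ℕ.+ suc r)) (sym (ℕ.m∸n+n≡m r≤n)) ⟩
  negOnePow (suc (n ∸ r ℕ.+ r) ℕ.+ suc r)
    ≡⟨ cong negOnePow (shuffle (n ∸ r) r) ⟩
  negOnePow ((n ∸ r) ℕ.+ (suc r ℕ.+ suc r))
    ≡⟨ trans (negOnePow-+ (n ∸ r) (suc r ℕ.+ suc r)) (cong (negOnePow (n ∸ r) *_) (trans (negOnePow-+ (suc r) (suc r)) (negOnePow-square (suc r)))) ⟩
  negOnePow (n ∸ r) * 1ℚ
    ≡⟨ *-identityʳ (negOnePow (n ∸ r)) ⟩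
  negOnePow (n ∸ r) ∎
  where
  open ≡-Reasoning
  shuffle : ∀ k r → suc (k ℕ.+ r) ℕ.+ suc r ≡ k ℕ.+ (suc r ℕ.+ suc r)
  shuffle = solve-∀
  r≤n : r ≤ n
  r≤n = ℕ.≤-pred (ℕ.≤-trans (ℕ.≤-reflexive (sym rank)) (ℕ.≤-trans (Matroid.rk-card M ⊤) (ℕ.≤-reflexive (∣⊤∣≡n (suc n)))))

theorem6p9 : (n r : ℕ) (M : Matroid (suc n)) → Loopless M → Matroid.rk M ⊤ ≡ suc r →
    (d : Vector ℕ (suc n)) → sumVec d ≡ r →
    (φ : List (Subset (suc n)) → ℚ) → IsDegreeMap M r φ →
    evalProd φ (Λprod n d) ≡ rhs n r M d
theorem6p9 n r M loopless rank d sum-d φ isDegree = begin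
  evalProd φ (Λprod n d)
    ≡⟨ cong (evalProd φ) (Λprod-word n d) ⟩
  evalProd φ (map (Λ n) (word d))
    ≡⟨ Degree.degree-flag M loopless rank φ isDegree (word d) [] (word-bounded d) ⊥≢⊤ (trans (word-length d) sum-d) ⟩
  V M (word d) ⊥ ⊤
    ≡⟨ cong (_* between (exponent M (word d)) ⊥ ⊤) (sgn-total n r M rank) ⟩
  negOnePow (n ∸ r) * between (exponent M (word d)) ⊥ ⊤
    ≡⟨ sym (rhs-pathsTo n r M rank d sum-d) ⟩
  rhs n r M d ∎
  where
  open ≡-Reasoning
  ⊥≢⊤ : ⊥ {n = suc n} ≢ ⊤
  ⊥≢⊤ ()
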